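{- Consider one-player games with the $AE_L$ objective $\mathsf{Energy}_{L}(0)\cap\mathsf{AvgEnergy}(t)$, $t\in\mathbb{Q}$. Pseudo-polynomial-memory strategies are both sufficient and necessary to win for player 1 in such games (games with $S_2=\emptyset$): whenever player 1 has a winning strategy, player 1 has one with pseudo-polynomial memory; and there is a family of such games won by player 1 in which every winning strategy requires memory polynomial in the values of the weights (hence not polynomial in the encoding size of the game). Memoryless strategies suffice for player 2 in such games (games with $S_1=\emptyset$): whenever player 2 has a winning strategy against the $AE_L$ objective, player 2 has a memoryless one.
   Context: A game is a tuple $G=(S_1,S_2,E,w)$ where $S_1,S_2$ are disjoint finite sets of states belonging to player 1 and player 2, $S=S_1\uplus S_2$, $E\subseteq S\times S$ is a finite set of edges such that every state has at least one outgoing edge, and $w\colon E\to\mathbb{Z}$ is an integer weight function. $G$ is one-player if $S_1=\emptyset$ or $S_2=\emptyset$. A play from an initial state $s_{\mathrm{init}}\in S$ is an infinite sequence $\pi=s_0s_1s_2\dots$ with $s_0=s_{\mathrm{init}}$ and $(s_i,s_{i+1})\in E$ for all $i\ge 0$; $\pi(n)=s_0\dots s_n$ is its prefix up to position $n$. A strategy for player $i$ is a function mapping each finite prefix ending in a state of $S_i$ to a successor (along an edge) of its last state; it is memoryless if it depends only on the last state, and finite-memory if it can be encoded by a deterministic finite-state Moore machine, its memory being measured by the number of states of that machine. Strategies of the two players and $s_{\mathrm{init}}$ determine a unique play, the outcome. The energy level is $\mathrm{EL}(\pi(n))=\sum_{i=0}^{n-1}w(s_i,s_{i+1})$, and the average-energy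 of $\pi$ is $\overline{AE}(\pi)=\limsup_{n\to\infty}\frac1n\sum_{i=1}^{n}\mathrm{EL}(\pi(i))$. $\mathsf{AvgEnergy}(t)$ is the set of plays $\pi$ with $\overline{AE}(\pi)\le t$. For $c\in\mathbb{N}$, $\mathsf{Energy}_{L}(c)$ is the set of plays $\pi$ with $c+\mathrm{EL}(\pi(n))\ge 0$ for all $n\ge 0$. A strategy of player 1 is winning from $s_{\mathrm{init}}$ for an objective $\mathcal W$ (a set of plays) if, for every strategy of player 2, the outcome lies in $\mathcal W$; a strategy of player 2 is winning (against $\mathcal W$) if, for every strategy of player 1, the outcome does not lie in $\mathcal W$. Sizes of games are measured with weights and thresholds encoded in binary. Pseudo-polynomial memory means a number of memory states bounded by a fixed polynomial in the number of states and edges of the game and in the values (not the encoding lengths) of the numbers involved (weights and threshold). "Requires memory polynomial in the values of the weights" means: there is a constant $\epsilon>0$ such that, $W$ denoting the largest absolute weight of a game of the family, every winning strategy needs at least $W^{\epsilon}$ memory states for all sufficiently large $W$, with $W$ unbounded along the family and the encoding size polynomial in $\log W$. -}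

module Defs where

open import Data.Bool.Base using (Bool; T)
open import Data.Bool.Properties using (T?)
open import Data.Fin.Base using (Fin)
open import Data.Integer.Base as ℤ using (ℤ; 0ℤ; ∣_∣)
open import Data.List.Base
  using (List; _++_; map; mapMaybe; allFin; cartesianProduct; length; sum)
open import Data.List.Extrema.Nat using (max)
open import Data.Maybe.Base as Maybe using ()
open import Data.Nat.Base using (ℕ; zero; suc; _+_; _*_; _≤_)
open import Data.Nat.Logarithm using (⌊log₂_⌋)
open import Data.Product.Base using (Σ-syntax; ∃; ∃-syntax; _,_; proj₁; proj₂)
open import Data.Rational.Base as ℚ using (ℚ; 0ℚ; ↥_; ↧ₙ_)
open import Data.Vec.Base using (Vec; lookup)
open import Level using (0ℓ)
open import Relation.Binary.PropositionalEquality.Core using (_≡_)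
open import Relation.Nullary.Decidable.Core using (dec⇒maybe)
open import Relation.Unary using (Pred; _∈_; _∉_; _∩_)

------------------------------------------------------------------------
-- Games

data Player : Set where
  one two : Player

-- The set Sᵢ is Fin (size i); the states form the disjoint union of S₁ and S₂.
-- E is a decidable relation, so that the finite set of edges can be enumerated.
record Game : Set where
  field
    size : Player → ℕ

  State : Set
  State = Σ[ i ∈ Player ] Fin (size i)

  field
    edge : State → State → Bool

  Edge : Set
  Edge = Σ[ s ∈ State ] Σ[ s′ ∈ State ] T (edge s s′)

  Successor : State → Set
  Successor s = Σ[ s′ ∈ State ] T (edge s s′)

  field
    total  : ∀ s → Successor s
    weight : Edge → ℤ

  states : List State
  states = map (one ,_) (allFin (size one)) ++ map (two ,_) (allFin (size two))

  edges : List Edge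
  edges = mapMaybe
    (λ (s , s′) → Maybe.map (λ e → s , s′ , e) (dec⇒maybe (T? (edge s s′))))
    (cartesianProduct states states)

  maxWeight : ℕ
  maxWeight = max 0 (map (λ e → ∣ weight e ∣) edges)

------------------------------------------------------------------------
-- Plays and objectives

-- a limsup≤ t  says that limsup a ≤ t in the extended reals: for every ε > 0,
-- some tail of a is bounded above by t + ε.
_limsup≤_ : (ℕ → ℚ) → ℚ → Set
a limsup≤ t = ∀ ε → 0ℚ ℚ.< ε → ∃[ N ] ∀ n → N ≤ n → a n ℚ.≤ t ℚ.+ ε

module _ (G : Game) where
  open Game G

  record Play : Set where
    field
      at   : ℕ → State
      step : ∀ n → T (edge (at n) (at (suc n)))

  -- EL π n is the energy level of the prefix s₀ … sₙ.
  EL : Play → ℕ → ℤ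
  EL π zero    = 0ℤ
  EL π (suc n) = EL π n ℤ.+ weight (at n , at (suc n) , step n)
    where open Play π

  -- EL π 1 + … + EL π n
  sumEL : Play → ℕ → ℤ
  sumEL π zero    = 0ℤ
  sumEL π (suc n) = sumEL π n ℤ.+ EL π (suc n)

  -- The n-th term is the average over the first n + 1 levels, avoiding the
  -- undefined average over none; the shift does not affect the limsup.
  averages : Play → ℕ → ℚ
  averages π n = sumEL π (suc n) ℚ./ suc n

  Objective : Set₁
  Objective = Pred Play 0ℓ

  EnergyL : ℕ → Objective
  EnergyL c π = ∀ n → 0ℤ ℤ.≤ ℤ.+ c ℤ.+ EL π n

  AvgEnergy : ℚ → Objective
  AvgEnergy t π = averages π limsup≤ t

------------------------------------------------------------------------
-- Strategies

  -- Finite prefixes of plays, indexed by their first and last states.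
  data Prefix (s₀ : State) : State → Set where
    start : Prefix s₀ s₀
    _▷_   : ∀ {s s′} → Prefix s₀ s → T (edge s s′) → Prefix s₀ s′

  Strategy : Player → Set
  Strategy i = ∀ s₀ k → Prefix s₀ (i , k) → Successor (i , k)

  module _ (σ : Strategy one) (τ : Strategy two) (s₀ : State) where

    move : ∀ s → Prefix s₀ s → Successor s
    move (one , k) h = σ s₀ k h
    move (two , k) h = τ s₀ k h

    prefix : ℕ → ∃ (Prefix s₀)
    prefix zero    = s₀ , start
    prefix (suc n) with prefix n
    ... | s , h = proj₁ (move s h) , h ▷ proj₂ (move s h)

    outcome : Play
    outcome = record
      { at   = λ n → proj₁ (prefix n)
      ; step = λ n → proj₂ (move (proj₁ (prefix n)) (proj₂ (prefix n)))
      }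

  Winning₁ : State → Objective → Strategy one → Set
  Winning₁ s₀ W σ = ∀ (τ : Strategy two) → outcome σ τ s₀ ∈ W

  Winning₂ : State → Objective → Strategy two → Set
  Winning₂ s₀ W τ = ∀ (σ : Strategy one) → outcome σ τ s₀ ∉ W

  Memoryless : ∀ {i} → Strategy i → Set
  Memoryless {i} σ = ∀ {s₀ s₀′ k} (h : Prefix s₀ (i , k)) (h′ : Prefix s₀′ (i , k)) →
    σ s₀ k h ≡ σ s₀′ k h′

  -- The memory is updated with a state when the play leaves that state; the
  -- next move is chosen from the current memory and the current state.
  record Moore (i : Player) (m : ℕ) : Set where
    field
      initial : Fin m
      update  : Fin m → State → Fin m
      next    : Fin m → ∀ k → Successor (i , k)

    memory : ∀ {s₀ s} → Prefix s₀ s → Fin m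
    memory start             = initial
    memory (_▷_ {s = s} h _) = update (memory h) s

    strategy : Strategy i
    strategy s₀ k h = next (memory h) k

  -- σ is encoded by a Moore machine with m states.
  HasMemory : ∀ {i} → Strategy i → ℕ → Set
  HasMemory {i} σ m =
    Σ[ M ∈ Moore i m ] ∀ s₀ k h → Moore.strategy M s₀ k h ≡ σ s₀ k h

------------------------------------------------------------------------
-- Polynomials in n variables

-- Natural coefficients lose no generality, as polynomials only serve as upper
-- bounds on natural numbers.
data Poly (n : ℕ) : Set where
  con     : ℕ → Poly n
  var     : Fin n → Poly n
  _⊕_ _⊗_ : Poly n → Poly n → Poly n

⟦_⟧ : ∀ {n} → Poly n → Vec ℕ n → ℕ
⟦ con c ⟧ ρ = c
⟦ var x ⟧ ρ = lookup ρ x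
⟦ p ⊕ q ⟧ ρ = ⟦ p ⟧ ρ + ⟦ q ⟧ ρ
⟦ p ⊗ q ⟧ ρ = ⟦ p ⟧ ρ * ⟦ q ⟧ ρ

------------------------------------------------------------------------
-- Instances of the AE_L problem

bits : ℕ → ℕ
bits n = suc ⌊log₂ n ⌋

record Instance : Set where
  field
    game      : Game
    init      : Game.State game
    threshold : ℚ

  open Game game public

  AEL : Objective game
  AEL = EnergyL game 0 ∩ AvgEnergy game threshold

  Wins₁ : Strategy game one → Set
  Wins₁ = Winning₁ game init AEL

  Wins₂ : Strategy game two → Set
  Wins₂ = Winning₂ game init AEL

  ∣S∣ ∣E∣ ∣num∣ den : ℕ
  ∣S∣   = length states
  ∣E∣   = length edges
  ∣num∣ = ∣ ↥ threshold ∣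
  den   = ↧ₙ threshold

  -- Weights and threshold are written in binary.
  encodingSize : ℕ
  encodingSize = ∣S∣ + ∣E∣ + sum (map (λ e → bits ∣ weight e ∣) edges)
               + bits ∣num∣ + bits den

module Submission where

-- For t = p / q, call q e − p the surplus of an energy level e: a play whose
-- accumulated surplus is bounded above has average-energy at most t.
--
-- Player 1, sufficiency: erase the loops of a winning play in the graph of the
-- configurations (state, level). Only the levels up to |p| have a nonpositive
-- surplus, so the surplus of a loop-free path is bounded below, and after a
-- slight increase of t the accumulated surplus of the play tends to −∞. Hence
-- some erased simple loop has nonpositive surplus, and the same count bounds
-- its length and its levels. If a path to this loop climbs high, two of its
-- nested excursions have the same end states, and the inner one, lowered, can
-- replace the outer one; so a short path exists, and memory can count the
-- remaining steps on the resulting lasso.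
--
-- Player 1, necessity: a play that has to take an edge of weight −W must first
-- count W rounds of a self-loop of weight 1, and cannot loop forever.
--
-- Player 2: if no memoryless strategy wins, all simple lassos satisfy the
-- objective, so their cycles have energy 0 and nonpositive surplus. Erasing the
-- loops of an arbitrary play then shows that it satisfies the objective too.

open import Defs
open import Data.Bool.Base using (Bool; true; false; T)
open import Data.Bool.Properties using (T?; T-irrelevant)
open import Data.Empty using (⊥; ⊥-elim)
open import Data.Fin.Base as Fin using (Fin; zero; suc; toℕ; fromℕ<; inject₁; combine; finToFun; funToFin)
import Data.Fin.Properties as Fin
open import Data.Integer.Base as ℤ using (ℤ; 0ℤ; 1ℤ; ∣_∣; +_; -[1+_])
import Data.Integer.Properties as ℤ
import Data.Integer.Tactic.RingSolver as ℤ-Solver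
open import Data.List.Base using (List; []; _∷_; _++_; map; length; filter; lookup; cartesianProduct)
open import Data.List.Extrema.Nat using (max≤v⁺; xs≤max)
import Data.List.Membership.DecPropositional as DecMembership
open import Data.List.Membership.Propositional using (_∈_)
open import Data.List.Membership.Propositional.Properties
  using (∈-++⁺ˡ; ∈-++⁺ʳ; ∈-∃++; ∈-lookup; ∈-map⁺; ∈-allFin; ∈-cartesianProduct⁺)
import Data.List.Properties as List
open import Data.List.Relation.Binary.Subset.Propositional using (_⊆_)
open import Data.List.Relation.Unary.All as All using (All; []; _∷_)
import Data.List.Relation.Unary.All.Properties as All
open import Data.List.Relation.Unary.AllPairs using ([]; _∷_)
open import Data.List.Relation.Unary.Any as Any using (here; there)
import Data.List.Relation.Unary.Any.Properties as Any
open import Data.List.Relation.Unary.Unique.Propositional using (Unique)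
import Data.List.Relation.Unary.Unique.Propositional.Properties as Unique
open import Data.Maybe.Base as Maybe using (just)
import Data.Maybe.Relation.Unary.Any as MAny
open import Data.Nat.Base as ℕ using (ℕ; zero; suc; _≤_; _<_; _^_; z≤n; s≤s)
open import Data.Nat.Induction using (<-wellFounded)
open import Data.Nat.Logarithm using (⌊log₂_⌋; ⌊log₂[2^n]⌋≡n)
import Data.Nat.Properties as ℕ
import Data.Nat.Tactic.RingSolver as ℕ-Solver
open import Data.Product.Base using (_×_; ∃; ∃-syntax; Σ-syntax; _,_; proj₁; proj₂)
import Data.Product.Properties as Product
open import Data.Rational.Base as ℚ using (ℚ; mkℚ; 0ℚ; ↥_; ↧_; ↧ₙ_; toℚᵘ; fromℚᵘ)
import Data.Rational.Properties as ℚ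
open import Data.Rational.Unnormalised.Base as ℚᵘ using (mkℚᵘ; *≤*; *<*)
import Data.Rational.Unnormalised.Properties as ℚᵘ
open import Data.Sum.Base using (_⊎_; inj₁; inj₂)
open import Data.Unit.Base using (⊤; tt)
open import Data.Vec.Base using (_∷_; [])
open import Function.Base using (_∘_; id)
open import Induction.WellFounded using (Acc; acc)
open import Relation.Binary.Definitions using (DecidableEquality; tri<; tri≈; tri>)
open import Relation.Binary.PropositionalEquality
open import Relation.Nullary.Decidable
  using (Dec; yes; no; ¬?; map′; _×-dec_; _⊎-dec_; decidable-stable; dec⇒maybe)
open import Relation.Nullary.Negation using (¬_; contradiction)

-- Average-energy in terms of accumulated surplus

-- Separates an estimate into inequalities already known, summed up in `c ≤ d`, and a polynomial
-- identity left to the ring solver.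
≤-by-difference : ∀ {a b c d : ℤ} → c ℤ.≤ d → b ℤ.- a ≡ d ℤ.- c → a ℤ.≤ b
≤-by-difference c≤d eq =
  ℤ.0≤i-j⇒j≤i (subst (0ℤ ℤ.≤_) (sym eq) (ℤ.i≤j⇒0≤j-i c≤d))

i≤∣i∣ : ∀ i → i ℤ.≤ + ∣ i ∣
i≤∣i∣ (+ n)    = ℤ.≤-refl
i≤∣i∣ -[1+ n ] = ℤ.-≤+

-∣i∣≤i : ∀ i → ℤ.- + ∣ i ∣ ℤ.≤ i
-∣i∣≤i i = ≤-by-difference (i≤∣i∣ (ℤ.- i))
  (trans (cong (λ n → i ℤ.- (ℤ.- + n)) (sym (ℤ.∣-i∣≡∣i∣ i))) (lemma i (+ ∣ ℤ.- i ∣)))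
  where
  lemma : ∀ i n → i ℤ.- (ℤ.- n) ≡ n ℤ.- (ℤ.- i)
  lemma = ℤ-Solver.solve-∀

-- The average a n / (n + 1) is at most t if and only if the excess is at most 0.
excess : ℚ → (ℕ → ℤ) → ℕ → ℤ
excess t a n = ↧ t ℤ.* a n ℤ.- ↥ t ℤ.* + suc n

average≤ᵘ : ∀ t ε x n → x ℚ./ suc n ℚ.≤ t ℚ.+ ε → mkℚᵘ x n ℚᵘ.≤ toℚᵘ t ℚᵘ.+ toℚᵘ ε
average≤ᵘ t ε x n h =
  ℚᵘ.≤-respˡ-≃ (ℚ.toℚᵘ-fromℚᵘ (mkℚᵘ x n))
    (ℚᵘ.≤-respʳ-≃ (ℚ.toℚᵘ-homo-+ t ε) (ℚ.toℚᵘ-mono-≤ h))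

average≤ᵘ⁻ : ∀ t ε x n → mkℚᵘ x n ℚᵘ.≤ toℚᵘ t ℚᵘ.+ toℚᵘ ε → x ℚ./ suc n ℚ.≤ t ℚ.+ ε
average≤ᵘ⁻ t ε x n h = ℚ.toℚᵘ-cancel-≤
  (ℚᵘ.≤-respˡ-≃ (ℚᵘ.≃-sym (ℚ.toℚᵘ-fromℚᵘ (mkℚᵘ x n)))
    (ℚᵘ.≤-respʳ-≃ (ℚᵘ.≃-sym (ℚ.toℚᵘ-homo-+ t ε)) h))

bounded-excess⇒limsup≤ : ∀ t (a : ℕ → ℤ) (C : ℕ) → (∀ n → excess t a n ℤ.≤ + C) →
  (λ n → a n ℚ./ suc n) limsup≤ t
bounded-excess⇒limsup≤ t@record{} a C bound ε@(mkℚ (+ zero) _ _) (ℚ.*<* (ℤ.+<+ ()))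
bounded-excess⇒limsup≤ t@record{} a C bound ε@(mkℚ (-[1+ _ ]) _ _) (ℚ.*<* ())
bounded-excess⇒limsup≤ t@record{} a C bound ε@(mkℚ (+ suc u) v-1 _) 0<ε =
  -- The average exceeds `t` by at most `C / (q (n + 1))`, which is below `ε = (u + 1) / v` as soon
  -- as `n ≥ C v`.
  C ℕ.* v , λ n Cv≤n → average≤ᵘ⁻ t ε (a n) n (*≤* (goal n Cv≤n))
  where
  p = ↥ t
  q = ↧ t
  v = suc v-1
  scaled : ∀ n → C ℕ.* v ≤ n → + v ℤ.* excess t a n ℤ.≤ + suc u ℤ.* q ℤ.* + suc n
  scaled n Cv≤n = begin
    + v ℤ.* excess t a n           ≤⟨ ℤ.*-monoˡ-≤-nonNeg (+ v) (bound n) ⟩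
    + v ℤ.* + C                    ≡⟨ ℤ.pos-* v C ⟨
    + (v ℕ.* C)                    ≤⟨ ℤ.+≤+ (ℕ.≤-trans (ℕ.≤-reflexive (ℕ.*-comm v C)) Cv≤n) ⟩
    + n                            ≤⟨ ℤ.+≤+ (ℕ.n≤1+n n) ⟩
    + suc n                        ≤⟨ ℤ.+≤+ (ℕ.m≤n*m (suc n) (suc u ℕ.* ↧ₙ t)) ⟩
    + (suc u ℕ.* ↧ₙ t ℕ.* suc n)   ≡⟨ trans (ℤ.pos-* (suc u ℕ.* ↧ₙ t) (suc n)) (cong (ℤ._* + suc n) (ℤ.pos-* (suc u) (↧ₙ t))) ⟩
    + suc u ℤ.* q ℤ.* + suc n      ∎
    where open ℤ.≤-Reasoning
  goal : ∀ n → C ℕ.* v ≤ n →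
    a n ℤ.* + (↧ₙ t ℕ.* v) ℤ.≤ (p ℤ.* + v ℤ.+ + suc u ℤ.* q) ℤ.* + suc n
  goal n Cv≤n = ≤-by-difference (scaled n Cv≤n)
    (trans (cong (λ z → (p ℤ.* + v ℤ.+ + suc u ℤ.* q) ℤ.* + suc n ℤ.- a n ℤ.* z) (ℤ.pos-* (↧ₙ t) v))
           (identity (a n) p q (+ v) (+ suc u) (+ suc n)))
    where
    identity : ∀ a p q v u m →
      (p ℤ.* v ℤ.+ u ℤ.* q) ℤ.* m ℤ.- a ℤ.* (q ℤ.* v)
      ≡ u ℤ.* q ℤ.* m ℤ.- v ℤ.* (q ℤ.* a ℤ.- p ℤ.* m)
    identity = ℤ-Solver.solve-∀

limsup≤⇒small-excess : ∀ t (a : ℕ → ℤ) → (λ n → a n ℚ./ suc n) limsup≤ t →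
  ∀ M-1 → ∃[ N ] ∀ n → N ≤ n → + suc M-1 ℤ.* excess t a n ℤ.≤ + suc n
limsup≤⇒small-excess t@record{} a lim M-1 with lim ε 0<ε
  where
  -- The successor of `d-1` is `M q` with `M = suc M-1`, so `ε = 1 / (M q)`.
  d-1 = ℚ.denominator-1 t ℕ.+ M-1 ℕ.* ↧ₙ t
  ε = fromℚᵘ (mkℚᵘ 1ℤ d-1)
  0<ε : 0ℚ ℚ.< ε
  0<ε = ℚ.toℚᵘ-cancel-< (ℚᵘ.<-respʳ-≃ (ℚᵘ.≃-sym (ℚ.toℚᵘ-fromℚᵘ (mkℚᵘ 1ℤ d-1))) (*<* (ℤ.+<+ (ℕ.s≤s ℕ.z≤n))))
... | N , tail = N , λ n N≤n → ≤-by-difference (cancelled n (tail n N≤n)) (identity₂ (a n) p q (+ M) (+ suc n))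
  where
  p = ↥ t
  q = ↧ t
  M = suc M-1
  d-1 = ℚ.denominator-1 t ℕ.+ M-1 ℕ.* ↧ₙ t
  ε = fromℚᵘ (mkℚᵘ 1ℤ d-1)
  identity₂ : ∀ a p q M m → m ℤ.- M ℤ.* (q ℤ.* a ℤ.- p ℤ.* m) ≡ (p ℤ.* M ℤ.+ 1ℤ) ℤ.* m ℤ.- a ℤ.* (q ℤ.* M)
  identity₂ = ℤ-Solver.solve-∀
  identity₃ : ∀ p q M m → (p ℤ.* (M ℤ.* q) ℤ.+ 1ℤ ℤ.* q) ℤ.* m ≡ (p ℤ.* M ℤ.+ 1ℤ) ℤ.* m ℤ.* q
  identity₃ = ℤ-Solver.solve-∀
  identity₄ : ∀ a q M → a ℤ.* (q ℤ.* (M ℤ.* q)) ≡ a ℤ.* (q ℤ.* M) ℤ.* q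
  identity₄ = ℤ-Solver.solve-∀
  cancelled : ∀ n → a n ℚ./ suc n ℚ.≤ t ℚ.+ ε →
    a n ℤ.* (q ℤ.* + M) ℤ.≤ (p ℤ.* + M ℤ.+ 1ℤ) ℤ.* + suc n
  cancelled n h with ℚᵘ.≤-respʳ-≃ (ℚᵘ.+-congʳ (toℚᵘ t) (ℚ.toℚᵘ-fromℚᵘ (mkℚᵘ 1ℤ d-1))) (average≤ᵘ t ε (a n) n h)
  ... | *≤* le = ℤ.*-cancelʳ-≤-pos _ _ q (subst₂ ℤ._≤_
    (trans (cong (a n ℤ.*_) (trans (ℤ.pos-* (↧ₙ t) (M ℕ.* ↧ₙ t)) (cong (q ℤ.*_) (ℤ.pos-* M (↧ₙ t))))) (identity₄ (a n) q (+ M)))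
    (trans (cong (λ z → (p ℤ.* z ℤ.+ 1ℤ ℤ.* q) ℤ.* + suc n) (ℤ.pos-* M (↧ₙ t))) (identity₃ p q (+ M) (+ suc n)))
    le)

-- A family that requires memory polynomial in the weights

n<2^n : ∀ n → n < 2 ^ n
n<2^n zero    = s≤s z≤n
n<2^n (suc n) = begin-strict
  suc n                 ≡⟨ ℕ.+-comm 1 n ⟩
  n ℕ.+ 1               <⟨ ℕ.+-mono-<-≤ (n<2^n n) (ℕ.>-nonZero⁻¹ (2 ^ n) {{ℕ.m^n≢0 2 n}}) ⟩
  2 ^ n ℕ.+ 2 ^ n       ≡⟨ cong (2 ^ n ℕ.+_) (ℕ.+-identityʳ (2 ^ n)) ⟨
  2 ^ suc n             ∎
  where open ℕ.≤-Reasoning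

⟦⟧-mono : ∀ (P : Poly 1) {x y} → x ≤ y → ⟦ P ⟧ (x ∷ []) ≤ ⟦ P ⟧ (y ∷ [])
⟦⟧-mono (con c)    x≤y = ℕ.≤-refl
⟦⟧-mono (var zero) x≤y = x≤y
⟦⟧-mono (P ⊕ Q)    x≤y = ℕ.+-mono-≤ (⟦⟧-mono P x≤y) (⟦⟧-mono Q x≤y)
⟦⟧-mono (P ⊗ Q)    x≤y = ℕ.*-mono-≤ (⟦⟧-mono P x≤y) (⟦⟧-mono Q x≤y)

-- Products of powers of two add the exponents, and sums cost one further bit, so an exponent linear
-- in `j` survives the induction.
⟦⟧-at-2^ : ∀ (P : Poly 1) → ∃[ a ] ∃[ d ] ∀ j → ⟦ P ⟧ (2 ^ j ∷ []) ≤ 2 ^ (a ℕ.+ d ℕ.* j)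
⟦⟧-at-2^ (con c)    = c , 0 , λ j →
  ℕ.≤-trans (ℕ.<⇒≤ (n<2^n c)) (ℕ.^-monoʳ-≤ 2 (ℕ.m≤m+n c 0))
⟦⟧-at-2^ (var zero) = 0 , 1 , λ j → ℕ.^-monoʳ-≤ 2 (ℕ.m≤m+n j 0)
⟦⟧-at-2^ (P ⊕ Q) with ⟦⟧-at-2^ P | ⟦⟧-at-2^ Q
... | a , d , P≤ | b , e , Q≤ = suc (a ℕ.+ b) , d ℕ.+ e , λ j →
  let x = a ℕ.+ d ℕ.* j
      y = b ℕ.+ e ℕ.* j
      open ℕ.≤-Reasoning
  in begin
    ⟦ P ⊕ Q ⟧ (2 ^ j ∷ [])                ≤⟨ ℕ.+-mono-≤ (P≤ j) (Q≤ j) ⟩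
    2 ^ x ℕ.+ 2 ^ y                       ≤⟨ ℕ.+-mono-≤ (ℕ.^-monoʳ-≤ 2 (ℕ.m≤m+n x y)) (ℕ.^-monoʳ-≤ 2 (ℕ.m≤n+m y x)) ⟩
    2 ^ (x ℕ.+ y) ℕ.+ 2 ^ (x ℕ.+ y)       ≡⟨ cong (2 ^ (x ℕ.+ y) ℕ.+_) (ℕ.+-identityʳ _) ⟨
    2 ^ suc (x ℕ.+ y)                     ≡⟨ cong (2 ^_) (exponents a b d e j) ⟩
    2 ^ (suc (a ℕ.+ b) ℕ.+ (d ℕ.+ e) ℕ.* j) ∎
  where
  exponents : ∀ a b d e j → suc ((a ℕ.+ d ℕ.* j) ℕ.+ (b ℕ.+ e ℕ.* j)) ≡ suc (a ℕ.+ b) ℕ.+ (d ℕ.+ e) ℕ.* j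
  exponents = ℕ-Solver.solve-∀
⟦⟧-at-2^ (P ⊗ Q) with ⟦⟧-at-2^ P | ⟦⟧-at-2^ Q
... | a , d , P≤ | b , e , Q≤ = a ℕ.+ b , d ℕ.+ e , λ j →
  let x = a ℕ.+ d ℕ.* j
      y = b ℕ.+ e ℕ.* j
      open ℕ.≤-Reasoning
  in begin
    ⟦ P ⊗ Q ⟧ (2 ^ j ∷ [])                ≤⟨ ℕ.*-mono-≤ (P≤ j) (Q≤ j) ⟩
    2 ^ x ℕ.* 2 ^ y                       ≡⟨ ℕ.^-distribˡ-+-* 2 x y ⟨
    2 ^ (x ℕ.+ y)                         ≡⟨ cong (2 ^_) (exponents a b d e j) ⟩
    2 ^ ((a ℕ.+ b) ℕ.+ (d ℕ.+ e) ℕ.* j)   ∎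
  where
  exponents : ∀ a b d e j → (a ℕ.+ d ℕ.* j) ℕ.+ (b ℕ.+ e ℕ.* j) ≡ (a ℕ.+ b) ℕ.+ (d ℕ.+ e) ℕ.* j
  exponents = ℕ-Solver.solve-∀

polynomial<exponential : ∀ (P : Poly 1) c → ∃[ k ] ⟦ P ⟧ (c ℕ.+ k ∷ []) ≤ 2 ^ k
polynomial<exponential P c with ⟦⟧-at-2^ P
... | a , d , P≤ = k , (begin
  ⟦ P ⟧ (c ℕ.+ k ∷ [])    ≡⟨ cong (λ x → ⟦ P ⟧ (x ∷ [])) (ℕ.m+[n∸m]≡n c≤2^j) ⟩
  ⟦ P ⟧ (2 ^ j ∷ [])      ≤⟨ P≤ j ⟩
  2 ^ (a ℕ.+ d ℕ.* j)     ≤⟨ ℕ.^-monoʳ-≤ 2 (ℕ.+-cancelˡ-≤ c _ _ (ℕ.≤-trans small (ℕ.≤-reflexive (sym (ℕ.m+[n∸m]≡n c≤2^j))))) ⟩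
  2 ^ k                   ∎)
  where
  open ℕ.≤-Reasoning
  b = c ℕ.+ a ℕ.+ d
  -- The linear exponent is then at most quadratic in `b`, hence below
  -- `(b + 1)³ ≤ (2 ^ b)³ = 2 ^ j`.
  j = b ℕ.* 3
  -- Makes the argument `c + k` exactly a power of two.
  k = 2 ^ j ℕ.∸ c
  cube : ∀ b → (b ℕ.+ b ℕ.* (b ℕ.* 3)) ℕ.+ (b ℕ.* b ℕ.* b ℕ.+ 2 ℕ.* b ℕ.+ 1)
    ≡ (1 ℕ.+ b) ℕ.* ((1 ℕ.+ b) ℕ.* ((1 ℕ.+ b) ℕ.* 1))
  cube = ℕ-Solver.solve-∀
  small : c ℕ.+ (a ℕ.+ d ℕ.* j) ≤ 2 ^ j
  small = begin
    c ℕ.+ (a ℕ.+ d ℕ.* j)   ≡⟨ ℕ.+-assoc c a (d ℕ.* j) ⟨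
    c ℕ.+ a ℕ.+ d ℕ.* j     ≤⟨ ℕ.+-mono-≤ (ℕ.m≤m+n (c ℕ.+ a) d) (ℕ.*-monoˡ-≤ j (ℕ.m≤n+m d (c ℕ.+ a))) ⟩
    b ℕ.+ b ℕ.* j           ≤⟨ ℕ.m≤m+n _ _ ⟩
    _                       ≡⟨ cube b ⟩
    suc b ^ 3               ≤⟨ ℕ.^-monoˡ-≤ 3 (n<2^n b) ⟩
    (2 ^ b) ^ 3             ≡⟨ ℕ.^-*-assoc 2 b 3 ⟩
    2 ^ j                   ∎
  c≤2^j : c ≤ 2 ^ j
  c≤2^j = ℕ.≤-trans (ℕ.m≤m+n c _) small

-- A game whose exit edge costs `W`

module Gates where
  open Instance
  open Play

  gateSize : Player → ℕ
  gateSize one = 2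
  gateSize two = 0

  gateEdge : (s s′ : Σ[ i ∈ Player ] Fin (gateSize i)) → Bool
  gateEdge (one , zero)     (one , _)        = true
  gateEdge (one , suc zero) (one , zero)     = false
  gateEdge (one , suc zero) (one , suc zero) = true

  gateTotal : ∀ s → Σ[ s′ ∈ (Σ[ i ∈ Player ] Fin (gateSize i)) ] T (gateEdge s s′)
  gateTotal (one , zero)     = (one , zero) , _
  gateTotal (one , suc zero) = (one , suc zero) , _

  gateWeight : ℕ → (Σ[ s ∈ (Σ[ i ∈ Player ] Fin (gateSize i)) ]
    Σ[ s′ ∈ (Σ[ i ∈ Player ] Fin (gateSize i)) ] T (gateEdge s s′)) → ℤ
  gateWeight W ((one , zero)     , (one , zero)     , _) = 1ℤ
  gateWeight W ((one , zero)     , (one , suc zero) , _) = ℤ.- + W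
  gateWeight W ((one , suc zero) , (one , suc zero) , _) = 0ℤ

  gate : ℕ → Game
  gate W = record
    { size   = gateSize
    ; edge   = gateEdge
    ; total  = gateTotal
    ; weight = gateWeight W
    }

  -- Threshold 0 forbids looping on the initial state forever, and the energy objective forbids
  -- leaving it before `W` loops.
  gateInstance : ℕ → Instance
  gateInstance W = record { game = gate W ; init = one , zero ; threshold = 0ℚ }

  gate-maxWeight : ∀ W → 1 ≤ W → maxWeight (gateInstance W) ≡ W
  gate-maxWeight W 1≤W = ℕ.≤-antisym
    (max≤v⁺ z≤n (1≤W ∷ ℕ.≤-reflexive (∣-+W∣≡W) ∷ z≤n ∷ []))
    (subst (_≤ maxWeight (gateInstance W)) ∣-+W∣≡W
      (All.head (All.tail (xs≤max 0 (map (λ e → ∣ gateWeight W e ∣) (Game.edges (gate W)))))))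
    where
    ∣-+W∣≡W : ∣ ℤ.- + W ∣ ≡ W
    ∣-+W∣≡W = ℤ.∣-i∣≡∣i∣ (+ W)

  -- Two states and three edges count 5, and the leading bits of three weights, numerator and
  -- denominator another 5.
  gate-encodingSize : ∀ W → encodingSize (gateInstance W) ≡ 10 ℕ.+ ⌊log₂ W ⌋
  gate-encodingSize W = begin
    5 ℕ.+ (1 ℕ.+ (bits ∣ ℤ.- + W ∣ ℕ.+ 1)) ℕ.+ 1 ℕ.+ 1
      ≡⟨ cong (λ n → 5 ℕ.+ (1 ℕ.+ (bits n ℕ.+ 1)) ℕ.+ 1 ℕ.+ 1) (ℤ.∣-i∣≡∣i∣ (+ W)) ⟩
    5 ℕ.+ (1 ℕ.+ (suc ⌊log₂ W ⌋ ℕ.+ 1)) ℕ.+ 1 ℕ.+ 1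
      ≡⟨ arith ⌊log₂ W ⌋ ⟩
    10 ℕ.+ ⌊log₂ W ⌋ ∎
    where
    open ≡-Reasoning
    arith : ∀ l → 5 ℕ.+ (1 ℕ.+ (suc l ℕ.+ 1)) ℕ.+ 1 ℕ.+ 1 ≡ 10 ℕ.+ l
    arith = ℕ-Solver.solve-∀

  prefixLength : ∀ {G s₀ s} → Prefix G s₀ s → ℕ
  prefixLength start   = 0
  prefixLength (h ▷ _) = suc (prefixLength h)

  module _ (W : ℕ) where

    waiting : Strategy (gate W) one
    waiting s₀ zero h with prefixLength h ℕ.<? W
    ... | yes _ = (one , zero) , _
    ... | no  _ = (one , suc zero) , _
    waiting s₀ (suc zero) h = (one , suc zero) , _

    module _ (τ : Strategy (gate W) two) where
      private
        π : Play (gate W)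
        π = outcome (gate W) waiting τ (one , zero)

      -- The invariant of the outcome: a climbing step adds at most `W` to the sum of the levels and
      -- a resting step nothing, so the sum stays below `W * W`.
      data Progress (n : ℕ) : ∀ s → Prefix (gate W) (one , zero) s → ℤ → ℤ → Set where
        climbing : ∀ {h e Σe} → n ≤ W → prefixLength h ≡ n → e ≡ + n → Σe ℤ.≤ + (n ℕ.* W) →
          Progress n (one , zero) h e Σe
        resting  : ∀ {h e Σe} → e ≡ 0ℤ → Σe ℤ.≤ + (W ℕ.* W) →
          Progress n (one , suc zero) h e Σe

      progress-step : ∀ {n s h e Σe} → Progress n s h e Σe →
        let m  = move (gate W) waiting τ (one , zero) s h
            e′ = e ℤ.+ gateWeight W (s , m)
        in Progress (suc n) (proj₁ m) (h ▷ proj₂ m) e′ (Σe ℤ.+ e′)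
      progress-step {n} {h = h} {Σe = Σe} (climbing n≤W refl refl Σe≤) with prefixLength h ℕ.<? W
      ... | yes n<W = climbing n<W refl (cong +_ (ℕ.+-comm n 1)) (begin
        Σe ℤ.+ + (n ℕ.+ 1)       ≤⟨ ℤ.+-mono-≤ Σe≤ (ℤ.+≤+ (ℕ.≤-trans (ℕ.≤-reflexive (ℕ.+-comm n 1)) n<W)) ⟩
        + (n ℕ.* W) ℤ.+ + W      ≡⟨ cong +_ (ℕ.+-comm (n ℕ.* W) W) ⟩
        + (suc n ℕ.* W)          ∎)
        where open ℤ.≤-Reasoning
      ... | no  n≮W = resting n-W≡0 (begin
        Σe ℤ.+ (+ n ℤ.+ ℤ.- + W) ≡⟨ cong (λ i → Σe ℤ.+ i) n-W≡0 ⟩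
        Σe ℤ.+ 0ℤ                ≡⟨ ℤ.+-identityʳ Σe ⟩
        Σe                       ≤⟨ Σe≤ ⟩
        + (n ℕ.* W)              ≤⟨ ℤ.+≤+ (ℕ.*-monoˡ-≤ W n≤W) ⟩
        + (W ℕ.* W)              ∎)
        where
        open ℤ.≤-Reasoning
        n-W≡0 : + n ℤ.+ ℤ.- + W ≡ 0ℤ
        n-W≡0 = trans (cong (λ i → + i ℤ.- + W) (ℕ.≤-antisym n≤W (ℕ.≮⇒≥ n≮W))) (ℤ.+-inverseʳ (+ W))
      progress-step {Σe = Σe} (resting refl Σe≤) =
        resting refl (ℤ.≤-trans (ℤ.≤-reflexive (ℤ.+-identityʳ Σe)) Σe≤)

      progress : ∀ n → let (s , h) = prefix (gate W) waiting τ (one , zero) n in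
        Progress n s h (EL _ π n) (sumEL _ π n)
      progress zero    = climbing z≤n refl refl (ℤ.+≤+ z≤n)
      progress (suc n) = progress-step (progress n)

      progress-energy : ∀ {n s h e Σe} → Progress n s h e Σe → 0ℤ ℤ.≤ e
      progress-energy (climbing _ _ refl _) = ℤ.+≤+ z≤n
      progress-energy (resting refl _)      = ℤ.≤-refl

      progress-sum : ∀ {n s h e Σe} → Progress n s h e Σe → Σe ℤ.≤ + (W ℕ.* W)
      progress-sum (climbing n≤W _ _ Σe≤) = ℤ.≤-trans Σe≤ (ℤ.+≤+ (ℕ.*-monoˡ-≤ W n≤W))
      progress-sum (resting _ Σe≤)        = Σe≤

      waiting-wins : AEL (gateInstance W) π
      waiting-wins =
        (λ n → subst (0ℤ ℤ.≤_) (sym (ℤ.+-identityˡ _)) (progress-energy (progress n))) ,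
        bounded-excess⇒limsup≤ 0ℚ (sumEL _ π ∘ suc) (W ℕ.* W) λ n →
          subst (ℤ._≤ + (W ℕ.* W)) (identity (sumEL _ π (suc n)) (+ suc n)) (progress-sum (progress (suc n)))
        where
        identity : ∀ x m → x ≡ 1ℤ ℤ.* x ℤ.- 0ℤ ℤ.* m
        identity = ℤ-Solver.solve-∀

  -- With at most W memory states, some memory state recurs during the W
  -- loops that must precede the edge of weight −W, so the play loops forever.
  module _ (W : ℕ) (σ : Strategy (gate W) one) (σ-wins : Wins₁ (gateInstance W) σ)
           (m : ℕ) (M : Moore (gate W) one m)
           (M≡σ : ∀ s₀ k h → Moore.strategy M s₀ k h ≡ σ s₀ k h) where

    private
      τ : Strategy (gate W) two
      τ _ ()

      π : Play (gate W)
      π = outcome (gate W) σ τ (one , zero)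

      history : ∀ n → Prefix (gate W) (one , zero) (at π n)
      history n = proj₂ (prefix (gate W) σ τ (one , zero) n)

      μ : ℕ → Fin m
      μ n = Moore.memory M (history n)

      LoopsUpTo : ℕ → Set
      LoopsUpTo n = at π n ≡ (one , zero) × EL _ π n ≡ + n

      move-≡ : ∀ s (h : Prefix (gate W) (one , zero) s) → s ≡ (one , zero) →
        proj₁ (move (gate W) σ τ (one , zero) s h) ≡ proj₁ (Moore.next M (Moore.memory M h) zero)
      move-≡ _ h refl = cong proj₁ (sym (M≡σ (one , zero) zero h))

      loop-level : ∀ {s s′} n e (h : T (gateEdge s s′)) → s ≡ (one , zero) → s′ ≡ (one , zero) →
        e ≡ + n → e ℤ.+ gateWeight W (s , s′ , h) ≡ + suc n
      loop-level n e h refl refl refl = cong +_ (ℕ.+-comm n 1)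

      -- Taking the exit at level `n < W` would lead to the negative level `n - W`.
      must-loop : ∀ {s s′} n e (h : T (gateEdge s s′)) → n < W → s ≡ (one , zero) → e ≡ + n →
        0ℤ ℤ.≤ e ℤ.+ gateWeight W (s , s′ , h) → s′ ≡ (one , zero)
      must-loop {s′ = one , zero}     n e h n<W refl refl 0≤ = refl
      must-loop {s′ = one , suc zero} n e h n<W refl refl 0≤ =
        contradiction n<W (ℕ.≤⇒≯ (ℤ.drop‿+≤+ (ℤ.0≤i-j⇒j≤i 0≤)))

      loops : ∀ n → n ≤ W → LoopsUpTo n
      loops zero    _   = refl , refl
      loops (suc n) n<W with loops n (ℕ.<⇒≤ n<W)
      ... | at≡ , EL≡ = at′≡ , loop-level n (EL _ π n) (step π n) at≡ at′≡ EL≡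
        where
        at′≡ : at π (suc n) ≡ (one , zero)
        at′≡ = must-loop n (EL _ π n) (step π n) n<W at≡ EL≡
          (subst (0ℤ ℤ.≤_) (ℤ.+-identityˡ _) (proj₁ (σ-wins τ) (suc n)))

      module _ {i j} (i<j : i < j) (j≤W : j ≤ W) (μᵢ≡μⱼ : μ i ≡ μ j) where

        -- Time `n` is matched with a time `r < j` of equal memory, at which the play loops. When
        -- `r` would reach `j`, it returns to `i`, where the memory is the same.
        shadow : ∀ n → at π n ≡ (one , zero) × (∃[ r ] r < j × μ n ≡ μ r)
        shadow zero    = refl , 0 , ℕ.≤-<-trans z≤n i<j , refl
        shadow (suc n) with shadow n
        ... | at≡ , r , r<j , μ≡ = at′≡ , next-r (ℕ.m≤n⇒m<n∨m≡n r<j)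
          where
          atᵣ≡ : at π r ≡ (one , zero)
          atᵣ≡ = proj₁ (loops r (ℕ.≤-trans (ℕ.<⇒≤ r<j) j≤W))
          at′≡ : at π (suc n) ≡ (one , zero)
          at′≡ = begin
            at π (suc n)                       ≡⟨ move-≡ (at π n) (history n) at≡ ⟩
            proj₁ (Moore.next M (μ n) zero)    ≡⟨ cong (λ x → proj₁ (Moore.next M x zero)) μ≡ ⟩
            proj₁ (Moore.next M (μ r) zero)    ≡⟨ move-≡ (at π r) (history r) atᵣ≡ ⟨
            at π (suc r)                       ≡⟨ proj₁ (loops (suc r) (ℕ.≤-trans r<j j≤W)) ⟩
            (one , zero)                       ∎
            where open ≡-Reasoning
          μ′≡ : μ (suc n) ≡ μ (suc r)
          μ′≡ = cong₂ (Moore.update M) μ≡ (trans at≡ (sym atᵣ≡))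
          next-r : suc r < j ⊎ suc r ≡ j → ∃[ r′ ] r′ < j × μ (suc n) ≡ μ r′
          next-r (inj₁ r′<j) = suc r , r′<j , μ′≡
          next-r (inj₂ refl) = i , i<j , trans μ′≡ (sym μᵢ≡μⱼ)

        loops-forever : ∀ n → EL _ π n ≡ + n × + n ℤ.≤ sumEL _ π n
        loops-forever zero    = refl , ℤ.≤-refl
        loops-forever (suc n) with loops-forever n
        ... | EL≡ , n≤Σ = EL′≡ , (begin
          + suc n                            ≡⟨ cong +_ (ℕ.+-comm 1 n) ⟩
          + n ℤ.+ 1ℤ                         ≤⟨ ℤ.+-mono-≤ n≤Σ (ℤ.+≤+ (s≤s z≤n)) ⟩
          sumEL _ π n ℤ.+ + suc n            ≡⟨ cong (λ i → sumEL _ π n ℤ.+ i) EL′≡ ⟨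
          sumEL _ π (suc n)                  ∎)
          where
          open ℤ.≤-Reasoning
          EL′≡ = loop-level n (EL _ π n) (step π n) (proj₁ (shadow n)) (proj₁ (shadow (suc n))) EL≡

        absurd : ⊥
        -- The argument 1 selects the factor 2: an excess of at most `(n + 1) / 2` is incompatible
        -- with a sum of levels of at least `n + 1`.
        absurd = from-small (limsup≤⇒small-excess 0ℚ (sumEL _ π ∘ suc) (proj₂ (σ-wins τ)) 1)
          where
          open ℤ.≤-Reasoning
          identity : ∀ x n → + 2 ℤ.* x ≡ + 2 ℤ.* (1ℤ ℤ.* x ℤ.- 0ℤ ℤ.* n)
          identity = ℤ-Solver.solve-∀
          from-small : (∃[ N ] ∀ n → N ≤ n → + 2 ℤ.* excess 0ℚ (sumEL _ π ∘ suc) n ℤ.≤ + suc n) → ⊥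
          from-small (N , small) = ℕ.<⇒≱ (ℕ.m<m+n (suc N) (s≤s z≤n)) (ℤ.drop‿+≤+ (begin
            + (suc N ℕ.+ suc N)                          ≡⟨ cong (λ n → + (suc N ℕ.+ n)) (ℕ.+-identityʳ (suc N)) ⟨
            + (2 ℕ.* suc N)                              ≡⟨ ℤ.pos-* 2 (suc N) ⟩
            + 2 ℤ.* + suc N                              ≤⟨ ℤ.*-monoˡ-≤-nonNeg (+ 2) (proj₂ (loops-forever (suc N))) ⟩
            + 2 ℤ.* sumEL _ π (suc N)                    ≡⟨ identity (sumEL _ π (suc N)) (+ suc N) ⟩
            + 2 ℤ.* excess 0ℚ (sumEL _ π ∘ suc) N        ≤⟨ small N ℕ.≤-refl ⟩
            + suc N                                      ∎))

    gate-memory : W < m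
    gate-memory = ℕ.≰⇒> λ m≤W →
      let i , j , i<j , μᵢ≡μⱼ = Fin.pigeonhole (s≤s m≤W) (μ ∘ toℕ)
      in absurd i<j (ℕ.≤-pred (Fin.toℕ<n j)) μᵢ≡μⱼ

  gates : ℕ → Instance
  gates k = gateInstance (2 ^ k)

  gates-maxWeight : ∀ k → maxWeight (gates k) ≡ 2 ^ k
  gates-maxWeight k = gate-maxWeight (2 ^ k) (ℕ.>-nonZero⁻¹ (2 ^ k) {{ℕ.m^n≢0 2 k}})

  gates-memory : ∀ k σ → Wins₁ (gates k) σ → ∀ m → HasMemory (game (gates k)) σ m → 2 ^ k < m
  gates-memory k σ wins m (M , M≡σ) = gate-memory (2 ^ k) σ wins m M M≡σ

  gate-encodingSize-log : ∀ W l → ⌊log₂ W ⌋ ≡ l → encodingSize (gateInstance W) ≡ 10 ℕ.+ l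
  gate-encodingSize-log W l refl = gate-encodingSize W

  gates-superpolynomial : ∀ (P : Poly 1) → (∃[ k ] ⟦ P ⟧ (10 ℕ.+ k ∷ []) ≤ 2 ^ k) →
    ∃[ k ] ∀ σ → Wins₁ (gates k) σ → ∀ m → HasMemory (game (gates k)) σ m →
    ⟦ P ⟧ (encodingSize (gates k) ∷ []) < m
  gates-superpolynomial P (k , P≤) = k , λ σ wins m h → ℕ.≤-<-trans
    (subst (λ x → ⟦ P ⟧ (x ∷ []) ≤ 2 ^ k)
      (sym (gate-encodingSize-log (2 ^ k) k (⌊log₂[2^n]⌋≡n k))) P≤)
    (gates-memory k σ wins m h)

  memory-necessary : Σ[ F ∈ (ℕ → Instance) ]
    (∀ k → size (F k) two ≡ 0) ×
    (∀ k → ∃ (Wins₁ (F k))) ×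
    (∀ B → ∃[ k ] B ≤ maxWeight (F k)) ×
    (Σ[ P ∈ Poly 1 ] ∀ k →
    encodingSize (F k) ≤ ⟦ P ⟧ (⌊log₂ maxWeight (F k) ⌋ ∷ [])) ×
    (∃[ p ] ∃[ q ] 0 < p × 0 < q × (∃[ W₀ ] ∀ k → W₀ ≤ maxWeight (F k) →
    ∀ σ → Wins₁ (F k) σ → ∀ m → HasMemory (game (F k)) σ m →
    maxWeight (F k) ^ p ≤ m ^ q)) ×
    (∀ (P : Poly 1) → ∃[ k ]
    ∀ σ → Wins₁ (F k) σ → ∀ m → HasMemory (game (F k)) σ m →
    ⟦ P ⟧ (encodingSize (F k) ∷ []) < m)
  memory-necessary = gates , (λ _ → refl) ,
    (λ k → waiting (2 ^ k) , waiting-wins (2 ^ k)) ,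
    (λ B → B , subst (B ≤_) (sym (gates-maxWeight B)) (ℕ.<⇒≤ (n<2^n B))) ,
    (con 10 ⊕ var zero , λ k → ℕ.≤-reflexive
      (gate-encodingSize-log (2 ^ k) _ (cong ⌊log₂_⌋ (sym (gates-maxWeight k))))) ,
    -- The exponent is `ε = 1 / 1`, and the bound holds from `W₀ = 0` on.
    (1 , 1 , s≤s z≤n , s≤s z≤n , 0 , λ k _ σ wins m h →
      ℕ.^-monoˡ-≤ 1 (subst (_≤ m) (sym (gates-maxWeight k)) (ℕ.<⇒≤ (gates-memory k σ wins m h)))) ,
    λ P → gates-superpolynomial P (polynomial<exponential P 10)

-- Walks and loop erasure

module _ {A : Set} where

  Unique-++⁻ : ∀ (xs : List A) {ys} → Unique (xs ++ ys) → Unique xs × Unique ys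
  Unique-++⁻ []       u       = [] , u
  Unique-++⁻ (x ∷ xs) (p ∷ u) =
    let uxs , uys = Unique-++⁻ xs u in All.++⁻ˡ xs p ∷ uxs , uys

  Unique⇒lookup-≢ : ∀ {xs : List A} → Unique xs → ∀ {i j} → i Fin.< j → lookup xs i ≢ lookup xs j
  Unique⇒lookup-≢ {x ∷ xs} (p ∷ u) {zero}  {suc j} _         = All.lookup p (∈-lookup j)
  Unique⇒lookup-≢ {x ∷ xs} (p ∷ u) {suc i} {suc j} (s≤s i<j) = Unique⇒lookup-≢ u i<j

  -- `Q` delimits the elements on which the code is injective; a longer list would repeat one of
  -- them by the pigeonhole principle.
  Unique⇒length≤ : ∀ {K} {Q : A → Set} (code : A → Fin K) →
    (∀ {x y} → Q x → Q y → code x ≡ code y → x ≡ y) →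
    ∀ {xs} → Unique xs → All Q xs → length xs ≤ K
  Unique⇒length≤ code injective {xs} u q = ℕ.≮⇒≥ λ K<∣xs∣ →
    let i , j , i<j , eq = Fin.pigeonhole K<∣xs∣ (code ∘ lookup xs)
    in Unique⇒lookup-≢ u i<j (injective (All.lookup q (∈-lookup i)) (All.lookup q (∈-lookup j)) eq)

  cost : (A → ℤ) → List A → ℤ
  cost φ []       = 0ℤ
  cost φ (x ∷ xs) = φ x ℤ.+ cost φ xs

  cost-++ : ∀ φ xs ys → cost φ (xs ++ ys) ≡ cost φ xs ℤ.+ cost φ ys
  cost-++ φ []       ys = sym (ℤ.+-identityˡ _)
  cost-++ φ (x ∷ xs) ys = trans (cong (ℤ._+_ (φ x)) (cost-++ φ xs ys)) (sym (ℤ.+-assoc (φ x) _ _))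

  cost-const : ∀ xs → cost (λ _ → 1ℤ) xs ≡ + length xs
  cost-const []       = refl
  cost-const (x ∷ xs) = cong (ℤ._+_ 1ℤ) (cost-const xs)

-- In a walk from u to v, the list contains the vertices before v, in reverse
-- order; position i of the walk is counted backwards from v.
module Walks {V : Set} (R : V → V → Set) where

  infixl 5 _▷_ _∙_

  data Walk (u : V) : List V → V → Set where
    []  : Walk u [] u
    _▷_ : ∀ {us v w} → Walk u us v → R v w → Walk u (v ∷ us) w

  _∙_ : ∀ {u us v vs w} → Walk u us v → Walk v vs w → Walk u (vs ++ us) w
  p ∙ []      = p
  p ∙ (q ▷ r) = (p ∙ q) ▷ r

  split : ∀ {u v w zs} ys → Walk u (ys ++ v ∷ zs) w → Walk u zs v × Walk v (ys ++ v ∷ []) w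
  split []       (p ▷ r) = p , [] ▷ r
  split (y ∷ ys) (p ▷ r) = let q , q′ = split ys p in q , q′ ▷ r

  at : ∀ {u us v} → Walk u us v → ℕ → V
  at {v = v} p       zero    = v
  -- Positions beyond the start default to the start.
  at {u}     []      (suc i) = u
  at         (p ▷ r) (suc i) = at p i

  at-step : ∀ {u us v} (p : Walk u us v) i → i < length us → R (at p (suc i)) (at p i)
  at-step (p ▷ r) zero    _         = r
  at-step (p ▷ r) (suc i) (s≤s i<n) = at-step p i i<n

  at-start : ∀ {u us v} (p : Walk u us v) → at p (length us) ≡ u
  at-start []      = refl
  at-start (p ▷ r) = at-start p

  at-∙ : ∀ {u us v vs w} (p : Walk u us v) (q : Walk v vs w) → at (p ∙ q) (length vs) ≡ v
  at-∙ p []      = refl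
  at-∙ p (q ▷ r) = at-∙ p q

  All-at : ∀ {Q : V → Set} {u us v} (p : Walk u us v) →
    (∀ i → i < length us → Q (at p (suc i))) → All Q us
  All-at []      h = []
  All-at (p ▷ r) h = h 0 (s≤s z≤n) ∷ All-at p λ i i<n → h (suc i) (s≤s i<n)

  segment : ∀ (Q : V → Set) (y : ℕ → V) a k →
    (∀ i → a ≤ i → i < k ℕ.+ a → R (y (suc i)) (y i) × Q (y (suc i))) →
    ∃[ us ] Walk (y (k ℕ.+ a)) us (y a) × length us ≡ k × All Q us
  segment Q y a zero    h = [] , [] , refl , []
  segment Q y a (suc k) h with segment Q y a k (λ i a≤i i<k+a → h i a≤i (ℕ.m<n⇒m<1+n i<k+a))
  ... | us , p , ∣us∣≡k , q = us ++ y (suc k ℕ.+ a) ∷ [] , ([] ▷ proj₁ top) ∙ p ,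
    trans (List.length-++ us) (trans (ℕ.+-comm (length us) 1) (cong suc ∣us∣≡k)) ,
    All.++⁺ q (proj₂ top ∷ [])
    where top = h (k ℕ.+ a) (ℕ.m≤n+m a k) ℕ.≤-refl

  segment′ : ∀ (Q : V → Set) (y : ℕ → V) {a b} → a ≤ b →
    (∀ i → a ≤ i → i < b → R (y (suc i)) (y i) × Q (y (suc i))) →
    ∃[ us ] Walk (y b) us (y a) × length us ≡ b ℕ.∸ a × All Q us
  segment′ Q y {a} {b} a≤b h =
    subst (λ b′ → ∃[ us ] Walk (y b′) us (y a) × length us ≡ b ℕ.∸ a × All Q us) (ℕ.m∸n+n≡m a≤b)
      (segment Q y a (b ℕ.∸ a) λ i a≤i i<b → h i a≤i (subst (i <_) (ℕ.m∸n+n≡m a≤b) i<b))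

  module LoopErasure (_≟_ : DecidableEquality V) (φ : V → ℤ) where
    open DecMembership _≟_ using (_∈?_)

    CheapCycle : V → Set
    CheapCycle u = ∃[ w ] ∃[ ys ] ∃[ zs ] Walk u zs w × Walk w (ys ++ w ∷ []) w ×
      Unique (ys ++ w ∷ []) × cost φ (ys ++ w ∷ []) ℤ.≤ 0ℤ

    SimpleWalk : List V → V → V → Set
    SimpleWalk us u v = ∃[ vs ] Walk u vs v × Unique (v ∷ vs) × vs ⊆ us × cost φ vs ℤ.≤ cost φ us

    -- Loops are erased as soon as they close. A loop of nonpositive cost is returned as the result;
    -- any other has positive cost, so removing it cannot raise the total.
    erase : ∀ {u us v} → Walk u us v → CheapCycle u ⊎ SimpleWalk us u v
    erase-step : ∀ {u us v w} → R v w → SimpleWalk us u v → CheapCycle u ⊎ SimpleWalk (v ∷ us) u w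

    erase []      = inj₂ ([] , [] , [] ∷ [] , id , ℤ.≤-refl)
    erase (p ▷ r) with erase p
    ... | inj₁ cycle  = inj₁ cycle
    ... | inj₂ simple = erase-step r simple

    erase-step {u} {us} {v} {w} r (vs , p , unique , vs⊆us , cost≤) with w ∈? (v ∷ vs)
    ... | no w∉ = inj₂ (v ∷ vs , p ▷ r , All.¬Any⇒All¬ (v ∷ vs) w∉ ∷ unique ,
      (λ { (here eq) → here eq ; (there x∈) → there (vs⊆us x∈) }) , ℤ.+-monoʳ-≤ (φ v) cost≤)
    ... | yes w∈ with ∈-∃++ w∈
    -- `ys ++ w ∷ []` is the loop just closed at `w`, and `zs` the walk that leads to `w`.
    ... | ys , zs , eq = shortcut (split ys (subst (λ xs → Walk u xs w) eq (p ▷ r)))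
                                  (subst Unique eq′ unique)
                                  (cost φ (ys ++ w ∷ []) ℤ.≤? 0ℤ)
      where
      eq′ : v ∷ vs ≡ (ys ++ w ∷ []) ++ zs
      eq′ = trans eq (sym (List.++-assoc ys (w ∷ []) zs))
      zs⊆ : zs ⊆ v ∷ us
      zs⊆ x∈ with subst (_ ∈_) (sym eq) (∈-++⁺ʳ ys (there x∈))
      ... | here  x≡v  = here x≡v
      ... | there x∈vs = there (vs⊆us x∈vs)
      shortcut : Walk u zs w × Walk w (ys ++ w ∷ []) w → Unique ((ys ++ w ∷ []) ++ zs) →
        Dec (cost φ (ys ++ w ∷ []) ℤ.≤ 0ℤ) → CheapCycle u ⊎ SimpleWalk (v ∷ us) u w
      shortcut (q , c) unq (yes c≤0) = inj₁ (w , ys , zs , q , c , proj₁ (Unique-++⁻ (ys ++ w ∷ []) unq) , c≤0)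
      shortcut (q , c) unq (no c≰0)  = inj₂ (zs , q ,
        proj₂ (Unique-++⁻ ys (subst Unique (List.++-assoc ys (w ∷ []) zs) unq)) , zs⊆ , (begin
        cost φ zs                                    ≡⟨ ℤ.+-identityˡ _ ⟨
        0ℤ ℤ.+ cost φ zs                             ≤⟨ ℤ.+-monoˡ-≤ (cost φ zs) (ℤ.<⇒≤ (ℤ.≰⇒> c≰0)) ⟩
        cost φ (ys ++ w ∷ []) ℤ.+ cost φ zs          ≡⟨ cost-++ φ (ys ++ w ∷ []) zs ⟨
        cost φ ((ys ++ w ∷ []) ++ zs)                ≡⟨ cong (cost φ) eq′ ⟨
        φ v ℤ.+ cost φ vs                            ≤⟨ ℤ.+-monoʳ-≤ (φ v) cost≤ ⟩
        φ v ℤ.+ cost φ us                            ∎))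
        where open ℤ.≤-Reasoning

-- Together with `first-below`, this searches outwards from a peak for the two ends of the excursion
-- around it.
last-below : ∀ {P : ℕ → Set} → (∀ n → Dec (P n)) → ∀ k → P 0 → ¬ P k →
  ∃[ j ] j < k × P j × (∀ r → j < r → r ≤ k → ¬ P r)
last-below P? zero    P0 ¬P0 = contradiction P0 ¬P0
last-below {P} P? (suc k) P0 ¬Psk with P? k
... | yes Pk = k , ℕ.≤-refl , Pk , λ r k<r r≤sk → subst (¬_ ∘ P) (ℕ.≤-antisym k<r r≤sk) ¬Psk
... | no ¬Pk with last-below P? k P0 ¬Pk
... | j , j<k , Pj , above = j , ℕ.m<n⇒m<1+n j<k , Pj , λ r j<r r≤sk → extend r j<r (ℕ.m≤n⇒m<n∨m≡n r≤sk)
  where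
  extend : ∀ r → j < r → r < suc k ⊎ r ≡ suc k → ¬ P r
  extend r j<r (inj₁ (s≤s r≤k)) = above r j<r r≤k
  extend r j<r (inj₂ refl)      = ¬Psk

first-below : ∀ {P : ℕ → Set} → (∀ n → Dec (P n)) → ∀ m k → ¬ P k → P (m ℕ.+ k) →
  ∃[ i ] k < i × i ≤ m ℕ.+ k × P i × (∀ r → k ≤ r → r < i → ¬ P r)
first-below P? zero    k ¬Pk Pk = contradiction Pk ¬Pk
first-below {P} P? (suc m) k ¬Pk Pn with P? (suc k)
... | yes Psk = suc k , ℕ.≤-refl , s≤s (ℕ.m≤n+m k m) , Psk ,
  λ r k≤r r<sk → subst (¬_ ∘ P) (ℕ.≤-antisym k≤r (ℕ.≤-pred r<sk)) ¬Pk
... | no ¬Psk with first-below P? m (suc k) ¬Psk (subst P (sym (ℕ.+-suc m k)) Pn)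
... | i , sk<i , i≤ , Pi , above = i , ℕ.<-trans ℕ.≤-refl sk<i , subst (i ≤_) (ℕ.+-suc m k) i≤ , Pi ,
  λ r k≤r r<i → extend r r<i (ℕ.m≤n⇒m<n∨m≡n k≤r)
  where
  extend : ∀ r → r < i → k < r ⊎ k ≡ r → ¬ P r
  extend r r<i (inj₁ k<r)  = above r k<r r<i
  extend r r<i (inj₂ refl) = ¬Pk

-- Short walks in graphs of configurations

-- A one-counter graph without zero tests: by `R-lower`, steps can be shifted down as long as the
-- heights remain natural numbers. One step changes the height by at most `W`.
module Counter {A : Set} {S : ℕ} (idx : A → Fin S) (idx-injective : ∀ {a b} → idx a ≡ idx b → a ≡ b)
  (R : A × ℕ → A × ℕ → Set) (W : ℕ)
  (R-lower : ∀ {s e s′ e′} d → R (s , e ℕ.+ d) (s′ , e′ ℕ.+ d) → R (s , e) (s′ , e′))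
  (R-rise : ∀ {s e s′ e′} → R (s , e) (s′ , e′) → e′ ≤ e ℕ.+ W)
  (R-fall : ∀ {s e s′ e′} → R (s , e) (s′ , e′) → e ≤ e′ ℕ.+ W)
  where

  open Walks R public

  Config : Set
  Config = A × ℕ

  height : Config → ℕ
  height = proj₂

  infix 4 _≟_
  _≟_ : DecidableEquality Config
  _≟_ = Product.≡-dec (λ a b → map′ idx-injective (cong idx) (idx a Fin.≟ idx b)) ℕ._≟_

  -- Capping the height at `B` makes the code total, at the price of injectivity above `B`.
  code : ∀ B → Config → Fin (S ℕ.* suc B)
  code B (s , e) = combine (idx s) (fromℕ< (s≤s (ℕ.m⊓n≤n e B)))

  code-injective : ∀ B {x y} → height x ≤ B → height y ≤ B → code B x ≡ code B y → x ≡ y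
  code-injective B {s , e} {s′ , e′} e≤B e′≤B eq =
    let s≡ , e≡ = Fin.combine-injective (idx s) _ (idx s′) _ eq
    in cong₂ _,_ (idx-injective s≡)
         (trans (sym (ℕ.m≤n⇒m⊓n≡m e≤B)) (trans (Fin.fromℕ<-injective _ _ _ _ e≡) (ℕ.m≤n⇒m⊓n≡m e′≤B)))

  lower : ℕ → Config → Config
  lower d (s , e) = s , e ℕ.∸ d

  lower-step : ∀ d {x y} → d ≤ height x → d ≤ height y → R x y → R (lower d x) (lower d y)
  lower-step d {s , e} {s′ , e′} d≤e d≤e′ r = R-lower d
    (subst₂ (λ m n → R (s , m) (s′ , n)) (sym (ℕ.m∸n+n≡m d≤e)) (sym (ℕ.m∸n+n≡m d≤e′)) r)

  lower-walk : ∀ d {u us v} → Walk u us v → d ≤ height v → All (λ c → d ≤ height c) us →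
    Walk (lower d u) (map (lower d) us) (lower d v)
  lower-walk d []      _   _        = []
  lower-walk d (p ▷ r) d≤v (d≤ ∷ a) = lower-walk d p d≤ a ▷ lower-step d d≤ d≤v r

  -- The stretch around `k` strictly above level `b`. As indices run against the walk, the walk
  -- enters it from `hi` and leaves it at `lo`.
  record Excursion (y : ℕ → Config) (n k b : ℕ) : Set where
    field
      lo hi  : ℕ
      lo<k   : lo < k
      k<hi   : k < hi
      hi≤n   : hi ≤ n
      lo-low : height (y lo) ≤ b
      hi-low : height (y hi) ≤ b
      above  : ∀ r → lo < r → r < hi → b < height (y r)

  excursion : ∀ y {n k} b → k ≤ n → height (y 0) ≤ b → height (y n) ≤ b → b < height (y k) →
    Excursion y n k b
  excursion y {n} {k} b k≤n start-low end-low peak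
    with last-below (λ r → height (y r) ℕ.≤? b) k start-low (ℕ.<⇒≱ peak)
       | first-below (λ r → height (y r) ℕ.≤? b) (n ℕ.∸ k) k (ℕ.<⇒≱ peak)
           (subst (λ r → height (y r) ≤ b) (sym (ℕ.m∸n+n≡m k≤n)) end-low)
  ... | lo , lo<k , lo-low , above₁ | hi , k<hi , hi≤ , hi-low , above₂ = record
    { lo = lo ; hi = hi ; lo<k = lo<k ; k<hi = k<hi ; lo-low = lo-low ; hi-low = hi-low
    ; hi≤n = subst (hi ≤_) (ℕ.m∸n+n≡m k≤n) hi≤
    ; above = above
    }
    where
    above : ∀ r → lo < r → r < hi → b < height (y r)
    above r lo<r r<hi with ℕ.≤-total r k
    ... | inj₁ r≤k = ℕ.≰⇒> (above₁ r lo<r r≤k)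
    ... | inj₂ k≤r = ℕ.≰⇒> (above₂ r k≤r r<hi)

  module _ (y : ℕ → Config) (n : ℕ) (step : ∀ i → i < n → R (y (suc i)) (y i)) where

    module Offsets {k b} (X : Excursion y n k b) where
      open Excursion X

      -- The step between `suc lo` and `lo` crosses the level `b` and changes the height by at most
      -- `W`.
      lo-offset : b ℕ.∸ height (y lo) < W
      lo-offset = ℕ.+-cancelˡ-< (height (y lo)) _ _
        (subst (_< height (y lo) ℕ.+ W) (sym (ℕ.m+[n∸m]≡n lo-low))
          (ℕ.<-≤-trans (above (suc lo) ℕ.≤-refl (ℕ.≤-<-trans lo<k k<hi))
            (R-fall (step lo (ℕ.<-≤-trans (ℕ.<-trans lo<k k<hi) hi≤n)))))

      hi-offset : b ℕ.∸ height (y hi) < W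
      hi-offset = bound hi k<hi refl
        where
        bound : ∀ h → k < h → h ≡ hi → b ℕ.∸ height (y hi) < W
        bound (suc h) (s≤s k≤h) refl = ℕ.+-cancelˡ-< (height (y hi)) _ _
          (subst (_< height (y hi) ℕ.+ W) (sym (ℕ.m+[n∸m]≡n hi-low))
            (ℕ.<-≤-trans (above h (ℕ.<-≤-trans lo<k k≤h) ℕ.≤-refl)
              (R-rise (step h hi≤n))))

      -- Both end states with their depths below `b`: for excursions with equal labels, the ends
      -- agree up to a vertical shift.
      label : Fin ((S ℕ.* W) ℕ.* (S ℕ.* W))
      label = combine (combine (idx (proj₁ (y lo))) (fromℕ< lo-offset))
                      (combine (idx (proj₁ (y hi))) (fromℕ< hi-offset))

    same-offset : ∀ {h h′} b d → h ≤ b → h′ ≤ b ℕ.+ d → b ℕ.∸ h ≡ (b ℕ.+ d) ℕ.∸ h′ → h′ ≡ h ℕ.+ d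
    same-offset {h} {h′} b d h≤b h′≤b+d eq = ℕ.+-cancelˡ-≡ (b ℕ.∸ h) _ _ (begin
      (b ℕ.∸ h) ℕ.+ h′            ≡⟨ cong (ℕ._+ h′) eq ⟩
      (b ℕ.+ d ℕ.∸ h′) ℕ.+ h′     ≡⟨ ℕ.m∸n+n≡m h′≤b+d ⟩
      b ℕ.+ d                     ≡⟨ cong (ℕ._+ d) (ℕ.m∸n+n≡m h≤b) ⟨
      (b ℕ.∸ h) ℕ.+ h ℕ.+ d       ≡⟨ ℕ.+-assoc (b ℕ.∸ h) h d ⟩
      (b ℕ.∸ h) ℕ.+ (h ℕ.+ d)     ∎)
      where open ≡-Reasoning

    -- Two nested excursions with the same label start in the same state and
    -- end in the same state, at heights that differ by d: the inner one,
    -- lowered by d, can replace the outer one.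
    nested⇒shorter : ∀ {k b d} (X : Excursion y n k b) (X′ : Excursion y n k (b ℕ.+ d)) → 0 < d →
      Offsets.label X ≡ Offsets.label X′ →
      ∃[ us ] Walk (y n) us (y 0) × length us < n
    nested⇒shorter {k} {b} {d} X X′ 0<d labels≡ = result
      where
      module X = Excursion X
      module X′ = Excursion X′
      halves = Fin.combine-injective (combine (idx (proj₁ (y X.lo))) (fromℕ< (Offsets.lo-offset X))) _
                                     (combine (idx (proj₁ (y X′.lo))) (fromℕ< (Offsets.lo-offset X′))) _ labels≡
      lo≡ = Fin.combine-injective (idx (proj₁ (y X.lo))) _ (idx (proj₁ (y X′.lo))) _ (proj₁ halves)
      hi≡ = Fin.combine-injective (idx (proj₁ (y X.hi))) _ (idx (proj₁ (y X′.hi))) _ (proj₂ halves)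
      height-lo : height (y X′.lo) ≡ height (y X.lo) ℕ.+ d
      height-lo = same-offset b d X.lo-low X′.lo-low (Fin.fromℕ<-injective _ _ _ _ (proj₂ lo≡))
      height-hi : height (y X′.hi) ≡ height (y X.hi) ℕ.+ d
      height-hi = same-offset b d X.hi-low X′.hi-low (Fin.fromℕ<-injective _ _ _ _ (proj₂ hi≡))
      lowered-lo : lower d (y X′.lo) ≡ y X.lo
      lowered-lo = cong₂ _,_ (sym (idx-injective (proj₁ lo≡)))
        (trans (cong (ℕ._∸ d) height-lo) (ℕ.m+n∸n≡m _ d))
      lowered-hi : lower d (y X′.hi) ≡ y X.hi
      lowered-hi = cong₂ _,_ (sym (idx-injective (proj₁ hi≡)))
        (trans (cong (ℕ._∸ d) height-hi) (ℕ.m+n∸n≡m _ d))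
      -- Strictness at this end makes the new walk shorter. Equal ends would differ in height by
      -- `d > 0`, and an outer end inside the inner excursion would lie above `b`.
      lo<lo′ : X.lo < X′.lo
      lo<lo′ with ℕ.<-cmp X.lo X′.lo
      ... | tri< < _ _ = <
      ... | tri≈ _ eq _ = contradiction
        (subst (ℕ._< height (y X.lo) ℕ.+ d) (trans (cong (height ∘ y) eq) height-lo)
          (ℕ.m<m+n _ 0<d)) (ℕ.<-irrefl refl)
      ... | tri> _ _ > = contradiction
        (ℕ.<-≤-trans (ℕ.≤-<-trans (ℕ.m≤m+n b d) (X′.above X.lo > (ℕ.<-trans X.lo<k X′.k<hi))) X.lo-low)
        (ℕ.<-irrefl refl)
      hi′≤hi : X′.hi ≤ X.hi
      hi′≤hi = ℕ.≮⇒≥ λ hi<hi′ → ℕ.<-irrefl refl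
        (ℕ.<-≤-trans (ℕ.≤-<-trans (ℕ.m≤m+n b d) (X′.above X.hi (ℕ.<-trans X′.lo<k X.k<hi) hi<hi′)) X.hi-low)
      lo′<hi′ : X′.lo < X′.hi
      lo′<hi′ = ℕ.<-trans X′.lo<k X′.k<hi
      before = segment′ (λ _ → ⊤) y X.hi≤n (λ i _ i<n → step i i<n , tt)
      after  = segment′ (λ _ → ⊤) y {0} {X.lo} z≤n (λ i _ i<lo → step i
        (ℕ.<-≤-trans (ℕ.<-trans i<lo (ℕ.<-trans X.lo<k X.k<hi)) X.hi≤n) , tt)
      d≤above : ∀ i → X′.lo ≤ i → i < X′.hi → d ≤ height (y (suc i))
      d≤above i lo≤i i<hi with ℕ.m≤n⇒m<n∨m≡n i<hi
      ... | inj₁ si<hi = ℕ.≤-trans (ℕ.m≤n+m d b) (ℕ.<⇒≤ (X′.above (suc i) (s≤s lo≤i) si<hi))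
      ... | inj₂ refl  = subst (d ≤_) (sym height-hi) (ℕ.m≤n+m d _)
      inner  = segment′ (λ c → d ≤ height c) y (ℕ.<⇒≤ lo′<hi′)
        (λ i lo≤i i<hi → step i (ℕ.<-≤-trans i<hi X′.hi≤n) , d≤above i lo≤i i<hi)
      result : ∃[ us ] Walk (y n) us (y 0) × length us < n
      result with before | inner | after
      ... | us₁ , p₁ , ∣us₁∣ , _ | us₂ , p₂ , ∣us₂∣ , high | us₃ , p₃ , ∣us₃∣ , _ =
        us₃ ++ (map (lower d) us₂ ++ us₁) ,
        p₁ ∙ subst₂ (λ a b → Walk a (map (lower d) us₂) b) lowered-hi lowered-lo
               (lower-walk d p₂ (subst (d ≤_) (sym height-lo) (ℕ.m≤n+m d _)) high) ∙ p₃ ,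
        (begin-strict
        length (us₃ ++ (map (lower d) us₂ ++ us₁))
          ≡⟨ trans (List.length-++ us₃) (cong (length us₃ ℕ.+_) (List.length-++ (map (lower d) us₂))) ⟩
        length us₃ ℕ.+ (length (map (lower d) us₂) ℕ.+ length us₁)
          ≡⟨ cong₂ ℕ._+_ ∣us₃∣ (cong₂ ℕ._+_ (trans (List.length-map (lower d) us₂) ∣us₂∣) ∣us₁∣) ⟩
        X.lo ℕ.+ ((X′.hi ℕ.∸ X′.lo) ℕ.+ (n ℕ.∸ X.hi))
          ≡⟨ ℕ.+-assoc X.lo _ _ ⟨
        X.lo ℕ.+ (X′.hi ℕ.∸ X′.lo) ℕ.+ (n ℕ.∸ X.hi)
          <⟨ ℕ.+-monoˡ-< (n ℕ.∸ X.hi) (ℕ.+-monoˡ-< (X′.hi ℕ.∸ X′.lo) lo<lo′) ⟩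
        X′.lo ℕ.+ (X′.hi ℕ.∸ X′.lo) ℕ.+ (n ℕ.∸ X.hi)
          ≡⟨ cong (ℕ._+ (n ℕ.∸ X.hi)) (ℕ.m+[n∸m]≡n (ℕ.<⇒≤ lo′<hi′)) ⟩
        X′.hi ℕ.+ (n ℕ.∸ X.hi)
          ≤⟨ ℕ.+-monoˡ-≤ (n ℕ.∸ X.hi) hi′≤hi ⟩
        X.hi ℕ.+ (n ℕ.∸ X.hi)
          ≡⟨ ℕ.m+[n∸m]≡n X.hi≤n ⟩
        n ∎)
        where open ℕ.≤-Reasoning

    -- Such a peak has excursions around it at `(S * W)² + 1` levels from `B` upwards, one more than
    -- there are labels.
    peak⇒shorter : ∀ {k} B → k ≤ n → height (y 0) ≤ B → height (y n) ≤ B →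
      B ℕ.+ (S ℕ.* W) ℕ.* (S ℕ.* W) < height (y k) →
      ∃[ us ] Walk (y n) us (y 0) × length us < n
    peak⇒shorter {k} B k≤n start-low end-low peak =
      let i , j , i<j , labels≡ = Fin.pigeonhole (ℕ.n<1+n N) (Offsets.label ∘ X)
      in nested (ℕ.+-monoʳ-< B i<j) (X i) (X j) labels≡
      where
      N = (S ℕ.* W) ℕ.* (S ℕ.* W)
      X : (ℓ : Fin (suc N)) → Excursion y n k (B ℕ.+ toℕ ℓ)
      X ℓ = excursion y (B ℕ.+ toℕ ℓ) k≤n (ℕ.m≤n⇒m≤n+o (toℕ ℓ) start-low) (ℕ.m≤n⇒m≤n+o (toℕ ℓ) end-low)
        (ℕ.≤-<-trans (ℕ.+-monoʳ-≤ B (ℕ.≤-pred (Fin.toℕ<n ℓ))) peak)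
      nested : ∀ {b b′} → b < b′ → (X : Excursion y n k b) (X′ : Excursion y n k b′) →
        Offsets.label X ≡ Offsets.label X′ → ∃[ us ] Walk (y n) us (y 0) × length us < n
      nested {b} b<b′ X X′ labels≡ with ℕ.m≤n⇒∃[o]m+o≡n (ℕ.<⇒≤ b<b′)
      ... | d , refl = nested⇒shorter X X′
        (ℕ.+-cancelˡ-< b 0 d (subst (_< b ℕ.+ d) (sym (ℕ.+-identityʳ b)) b<b′)) labels≡

  walkBound : ℕ → ℕ
  walkBound B = S ℕ.* suc (B ℕ.+ (S ℕ.* W) ℕ.* (S ℕ.* W))

  -- At cost 1 per vertex no cycle is cheap, so `erase` always yields a simple walk.
  cheapCycle⇒⊥ : ∀ {u} → ¬ LoopErasure.CheapCycle _≟_ (λ _ → 1ℤ) u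
  cheapCycle⇒⊥ (w , ys , _ , _ , _ , _ , c≤0) = ℕ.<⇒≱ (s≤s z≤n) (ℤ.drop‿+≤+
    (subst (ℤ._≤ 0ℤ) (trans (cost-const (ys ++ w ∷ [])) (cong +_ (trans (List.length-++ ys) (ℕ.+-comm (length ys) 1)))) c≤0))

  -- Cutting peaks terminates because each cut shortens the walk. Loop erasure then leaves distinct
  -- configurations of bounded height, which `walkBound` counts.
  shorten : ∀ B {us u v} → Walk u us v → Acc _<_ (length us) → height u ≤ B → height v ≤ B →
    ∃[ vs ] Walk u vs v × length vs ≤ walkBound B
  shorten B {us} {u} {v} p (acc rec) u-low v-low
    with ℕ.anyUpTo? (λ i → B ℕ.+ (S ℕ.* W) ℕ.* (S ℕ.* W) ℕ.<? height (at p (suc i))) (length us)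
  ... | yes (i , i<n , peak) =
    let vs , q , ∣vs∣<n = peak⇒shorter (at p) (length us) (at-step p) B i<n v-low
                            (subst (λ c → height c ≤ B) (sym (at-start p)) u-low) peak
    in shorten B (subst (λ c → Walk c vs v) (at-start p) q) (rec ∣vs∣<n) u-low v-low
  ... | no ¬peak with LoopErasure.erase _≟_ (λ _ → 1ℤ) p
  ... | inj₁ cycle = ⊥-elim (cheapCycle⇒⊥ cycle)
  ... | inj₂ (vs , q , (_ ∷ unique) , vs⊆us , _) = vs , q ,
    Unique⇒length≤ (code _) (code-injective _) unique
      (All.tabulate λ c∈vs → All.lookup (All-at p λ i i<n → ℕ.≮⇒≥ λ peak → ¬peak (i , i<n , peak)) (vs⊆us c∈vs))

-- Lassos with nonpositive surplus

module _ {A : Set} (φ : A → ℤ) (M D : ℤ) {Q : A → Set} (Q? : ∀ x → Dec (Q x))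
  (rest : ∀ x → ¬ Q x → M ℤ.≤ φ x) (few : ∀ x → M ℤ.≤ φ x ℤ.+ D) where

  -- Each entry costs at least `M`, except that one in `Q` may fall short by up to `D`.
  length≤cost+filter : ∀ xs → M ℤ.* + length xs ℤ.≤ cost φ xs ℤ.+ D ℤ.* + length (filter Q? xs)
  length≤cost+filter []       = ℤ.≤-reflexive (identity M D)
    where
    identity : ∀ M D → M ℤ.* 0ℤ ≡ 0ℤ ℤ.+ D ℤ.* 0ℤ
    identity = ℤ-Solver.solve-∀
  length≤cost+filter (x ∷ xs) with Q? x
  ... | yes _ = ≤-by-difference (ℤ.+-mono-≤ (few x) (length≤cost+filter xs))
    (identity M D (φ x) (cost φ xs) (+ length xs) (+ length (filter Q? xs)))
    where
    identity : ∀ M D x y l n → ((x ℤ.+ y) ℤ.+ D ℤ.* (1ℤ ℤ.+ n)) ℤ.- M ℤ.* (1ℤ ℤ.+ l)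
      ≡ ((x ℤ.+ D) ℤ.+ (y ℤ.+ D ℤ.* n)) ℤ.- (M ℤ.+ M ℤ.* l)
    identity = ℤ-Solver.solve-∀
  ... | no ¬q = ≤-by-difference (ℤ.+-mono-≤ (rest x ¬q) (length≤cost+filter xs))
    (identity M D (φ x) (cost φ xs) (+ length xs) (+ length (filter Q? xs)))
    where
    identity : ∀ M D x y l n → ((x ℤ.+ y) ℤ.+ D ℤ.* n) ℤ.- M ℤ.* (1ℤ ℤ.+ l)
      ≡ (x ℤ.+ (y ℤ.+ D ℤ.* n)) ℤ.- (M ℤ.+ M ℤ.* l)
    identity = ℤ-Solver.solve-∀

-- The hypothesis bounds `L G` by about `n / 2 + L P`. Subtracting one unit per position leaves
-- about `L P - n / 2`, and `n` is chosen to push this below `- H`.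
drift⇒cost< : ∀ (L P H N : ℕ) (G p : ℤ) → ℤ.- + P ℤ.≤ p →
  let n = N ℕ.+ 2 ℕ.* (L ℕ.* P ℕ.+ H) in
  + (2 ℕ.* L) ℤ.* (G ℤ.+ p) ℤ.≤ + suc n →
  + L ℤ.* G ℤ.- + (2 ℕ.+ n) ℤ.< ℤ.- + H
drift⇒cost< L P H N G p -P≤p drift = ℤ.*-cancelˡ-<-nonNeg (+ 2) (ℤ.suc[i]≤j⇒i<j
  (≤-by-difference
    (ℤ.+-mono-≤ (ℤ.+-mono-≤ drift (ℤ.*-monoˡ-≤-nonNeg (+ (2 ℕ.* L)) -P≤p)) (ℤ.+≤+ (z≤n {2 ℕ.+ N})))
    (begin
      + 2 ℤ.* (ℤ.- + H) ℤ.- (1ℤ ℤ.+ + 2 ℤ.* (+ L ℤ.* G ℤ.- (+ 2 ℤ.+ + n)))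
        ≡⟨ cong (λ i → + 2 ℤ.* (ℤ.- + H) ℤ.- (1ℤ ℤ.+ + 2 ℤ.* (+ L ℤ.* G ℤ.- (+ 2 ℤ.+ i)))) n≡ ⟩
      _ ≡⟨ identity (+ L) (+ P) (+ H) (+ N) G p ⟩
      _ ≡⟨ cong₂ (λ i j → ((1ℤ ℤ.+ i) ℤ.+ j ℤ.* p ℤ.+ (+ 2 ℤ.+ + N))
             ℤ.- (j ℤ.* (G ℤ.+ p) ℤ.+ j ℤ.* (ℤ.- + P) ℤ.+ 0ℤ)) (sym n≡) (sym (ℤ.pos-* 2 L)) ⟩
      _ ∎)))
  where
  open ≡-Reasoning
  n = N ℕ.+ 2 ℕ.* (L ℕ.* P ℕ.+ H)
  n≡ : + n ≡ + N ℤ.+ + 2 ℤ.* (+ L ℤ.* + P ℤ.+ + H)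
  n≡ = cong (ℤ._+_ (+ N)) (trans (ℤ.pos-* 2 (L ℕ.* P ℕ.+ H)) (cong (λ i → + 2 ℤ.* (i ℤ.+ + H)) (ℤ.pos-* L P)))
  identity : ∀ L P H N G p →
    + 2 ℤ.* (ℤ.- H) ℤ.- (1ℤ ℤ.+ + 2 ℤ.* (L ℤ.* G ℤ.- (+ 2 ℤ.+ (N ℤ.+ + 2 ℤ.* (L ℤ.* P ℤ.+ H)))))
    ≡ ((1ℤ ℤ.+ (N ℤ.+ + 2 ℤ.* (L ℤ.* P ℤ.+ H))) ℤ.+ (+ 2 ℤ.* L) ℤ.* p ℤ.+ (+ 2 ℤ.+ N))
      ℤ.- ((+ 2 ℤ.* L) ℤ.* (G ℤ.+ p) ℤ.+ (+ 2 ℤ.* L) ℤ.* (ℤ.- P) ℤ.+ 0ℤ)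
  identity = ℤ-Solver.solve-∀

module Lassos {A : Set} {S : ℕ} (idx : A → Fin S) (idx-injective : ∀ {a b} → idx a ≡ idx b → a ≡ b)
  (R : A × ℕ → A × ℕ → Set) (W : ℕ)
  (R-lower : ∀ {s e s′ e′} d → R (s , e ℕ.+ d) (s′ , e′ ℕ.+ d) → R (s , e) (s′ , e′))
  (R-rise : ∀ {s e s′ e′} → R (s , e) (s′ , e′) → e′ ≤ e ℕ.+ W)
  (R-fall : ∀ {s e s′ e′} → R (s , e) (s′ , e′) → e ≤ e′ ℕ.+ W)
  (t : ℚ)
  where

  open Counter idx idx-injective R W R-lower R-rise R-fall public

  -- `K` counts the configurations of height at most `P`, the only ones whose surplus can be
  -- nonpositive. `K * (2 + P)` will bound the length of a cheap simple cycle, `M` exceeds this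
  -- bound and `P`, and `- H` will bound the cost of distinct configurations from below.
  P K M L H : ℕ
  P = ∣ ↥ t ∣
  K = S ℕ.* suc P
  M = suc (K ℕ.* (2 ℕ.+ P) ℕ.+ P)
  L = suc M
  H = M ℕ.* (K ℕ.* (2 ℕ.+ P))

  surplus : Config → ℤ
  surplus c = ↧ t ℤ.* + height c ℤ.- ↥ t

  -- A cycle of length at most M has nonpositive cost if and only if its
  -- surplus is nonpositive, whereas the cost of a play satisfying the
  -- objective tends to −∞ even if its average is exactly t.
  φ : Config → ℤ
  φ c = + L ℤ.* surplus c ℤ.- 1ℤ

  height-P≤surplus : ∀ c → + height c ℤ.- + P ℤ.≤ surplus c
  height-P≤surplus c = ℤ.+-mono-≤
    (ℤ.≤-trans (ℤ.+≤+ (ℕ.m≤n*m (height c) (↧ₙ t))) (ℤ.≤-reflexive (ℤ.pos-* (↧ₙ t) (height c))))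
    (ℤ.neg-mono-≤ (i≤∣i∣ (↥ t)))

  -P≤surplus : ∀ c → ℤ.- + P ℤ.≤ surplus c
  -P≤surplus c = ℤ.≤-trans
    (ℤ.≤-trans (ℤ.≤-reflexive (sym (ℤ.+-identityˡ _))) (ℤ.+-monoˡ-≤ (ℤ.- + P) (ℤ.+≤+ z≤n)))
    (height-P≤surplus c)

  -- The surplus is an integer and positive above `P`, so the cost is at least `L - 1 = M`.
  M≤φ-high : ∀ c → P < height c → + M ℤ.≤ φ c
  M≤φ-high c P<e = ≤-by-difference (ℤ.*-monoˡ-≤-nonNeg (+ L) 0≤surplus-1) (identity (+ M) (surplus c))
    where
    shift : ∀ f e P → (f ℤ.- 1ℤ) ℤ.- (e ℤ.- (1ℤ ℤ.+ P)) ≡ f ℤ.- (e ℤ.- P)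
    shift = ℤ-Solver.solve-∀
    0≤surplus-1 : 0ℤ ℤ.≤ surplus c ℤ.- 1ℤ
    0≤surplus-1 = ℤ.≤-trans (ℤ.i≤j⇒0≤j-i (ℤ.+≤+ P<e))
      (≤-by-difference {+ height c ℤ.- + suc P} {surplus c ℤ.- 1ℤ} (height-P≤surplus c)
        (shift (surplus c) (+ height c) (+ P)))
    identity : ∀ M f → ((1ℤ ℤ.+ M) ℤ.* f ℤ.- 1ℤ) ℤ.- M ≡ (1ℤ ℤ.+ M) ℤ.* (f ℤ.- 1ℤ) ℤ.- (1ℤ ℤ.+ M) ℤ.* 0ℤ
    identity = ℤ-Solver.solve-∀

  -- The cost is at least `- L P - 1`, so the right-hand side is at least `2 M - P - 1`, and
  -- `P < M`.
  M≤φ-low : ∀ c → + M ℤ.≤ φ c ℤ.+ + M ℤ.* + (2 ℕ.+ P)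
  M≤φ-low c = ≤-by-difference
    (ℤ.+-mono-≤ (ℤ.*-monoˡ-≤-nonNeg (+ L) (-P≤surplus c)) (ℤ.+≤+ P<M))
    (identity (+ M) (+ P) (surplus c))
    where
    P<M : suc P ≤ M
    P<M = s≤s (ℕ.m≤n+m P _)
    identity : ∀ M P f → ((1ℤ ℤ.+ M) ℤ.* f ℤ.- 1ℤ ℤ.+ M ℤ.* (+ 2 ℤ.+ P)) ℤ.- M
      ≡ ((1ℤ ℤ.+ M) ℤ.* f ℤ.+ M) ℤ.- ((1ℤ ℤ.+ M) ℤ.* (ℤ.- P) ℤ.+ (1ℤ ℤ.+ P))
    identity = ℤ-Solver.solve-∀

  low? : ∀ c → Dec (height c ≤ P)
  low? c = height c ℕ.≤? P

  -- At most `K` members are low, and each falls short of `M` by at most `M * (2 + P)`; together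
  -- this is `H`.
  length≤cost : ∀ {us} → Unique us → + M ℤ.* + length us ℤ.≤ cost φ us ℤ.+ + H
  length≤cost {us} unique = ℤ.≤-trans
    (length≤cost+filter φ (+ M) (+ M ℤ.* + (2 ℕ.+ P)) low? (λ c e≰P → M≤φ-high c (ℕ.≰⇒> e≰P)) M≤φ-low us)
    (ℤ.+-monoʳ-≤ (cost φ us) (begin
    + M ℤ.* + (2 ℕ.+ P) ℤ.* + length (filter low? us)
      ≤⟨ ℤ.*-monoˡ-≤-nonNeg (+ M ℤ.* + (2 ℕ.+ P)) (ℤ.+≤+ low≤K) ⟩
    + M ℤ.* + (2 ℕ.+ P) ℤ.* + K
      ≡⟨ trans (cong (ℤ._* + K) (sym (ℤ.pos-* M (2 ℕ.+ P)))) (sym (ℤ.pos-* (M ℕ.* (2 ℕ.+ P)) K)) ⟩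
    + (M ℕ.* (2 ℕ.+ P) ℕ.* K)
      ≡⟨ cong +_ (trans (ℕ.*-assoc M (2 ℕ.+ P) K) (cong (M ℕ.*_) (ℕ.*-comm (2 ℕ.+ P) K))) ⟩
    + H ∎))
    where
    open ℤ.≤-Reasoning
    low≤K : length (filter low? us) ≤ K
    low≤K = Unique⇒length≤ (code P) (code-injective P) (Unique.filter⁺ low? unique) (All.all-filter low? us)

  -H≤cost : ∀ {us} → Unique us → ℤ.- + H ℤ.≤ cost φ us
  -H≤cost {us} unique = ≤-by-difference
    (ℤ.≤-trans (ℤ.≤-trans (ℤ.+≤+ z≤n) (ℤ.≤-reflexive (ℤ.pos-* M (length us)))) (length≤cost unique))
    (identity (cost φ us) (+ H))
    where
    identity : ∀ c h → c ℤ.- (ℤ.- h) ≡ (c ℤ.+ h) ℤ.- 0ℤ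
    identity = ℤ-Solver.solve-∀

  cost-φ : ∀ us → cost φ us ≡ + L ℤ.* cost surplus us ℤ.- + length us
  cost-φ []       = sym (trans (ℤ.+-identityʳ _) (ℤ.*-zeroʳ (+ L)))
  cost-φ (c ∷ us) = trans (cong (ℤ._+_ (φ c)) (cost-φ us)) (identity (+ L) (surplus c) (cost surplus us) (+ length us))
    where
    identity : ∀ L f g n → (L ℤ.* f ℤ.- 1ℤ) ℤ.+ (L ℤ.* g ℤ.- n) ≡ L ℤ.* (f ℤ.+ g) ℤ.- (1ℤ ℤ.+ n)
    identity = ℤ-Solver.solve-∀

  cheap⇒length≤ : ∀ {us} → Unique us → cost φ us ℤ.≤ 0ℤ → length us ≤ K ℕ.* (2 ℕ.+ P)
  cheap⇒length≤ {us} unique c≤0 = ℕ.*-cancelˡ-≤ M (ℤ.drop‿+≤+ (begin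
    + (M ℕ.* length us)     ≡⟨ ℤ.pos-* M (length us) ⟩
    + M ℤ.* + length us     ≤⟨ length≤cost unique ⟩
    cost φ us ℤ.+ + H       ≤⟨ ℤ.+-monoˡ-≤ (+ H) c≤0 ⟩
    0ℤ ℤ.+ + H              ≡⟨ ℤ.+-identityˡ (+ H) ⟩
    + H                     ∎))
    where open ℤ.≤-Reasoning

  -- A cheap list satisfies `L * surplus ≤ length < L`, which excludes a surplus of 1 or more.
  cheap⇒surplus≤0 : ∀ {us} → Unique us → cost φ us ℤ.≤ 0ℤ → cost surplus us ℤ.≤ 0ℤ
  cheap⇒surplus≤0 {us} unique c≤0 = ℤ.≮⇒≥ λ 0<surplus → ℕ.<-irrefl refl (ℤ.drop‿+<+ (begin-strict
    + length us                       ≤⟨ ℤ.+≤+ (cheap⇒length≤ unique c≤0) ⟩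
    + (K ℕ.* (2 ℕ.+ P))               <⟨ ℤ.+<+ (ℕ.≤-trans (s≤s (ℕ.m≤m+n _ P)) (ℕ.n≤1+n M)) ⟩
    + L                               ≡⟨ ℤ.*-identityʳ (+ L) ⟨
    + L ℤ.* 1ℤ                        ≤⟨ ℤ.*-monoˡ-≤-nonNeg (+ L) (ℤ.i<j⇒suc[i]≤j 0<surplus) ⟩
    + L ℤ.* cost surplus us           ≤⟨ ℤ.i-j≤0⇒i≤j (subst (ℤ._≤ 0ℤ) (cost-φ us) c≤0) ⟩
    + length us                       ∎))
    where open ℤ.≤-Reasoning

  B₀ : ℕ
  B₀ = H ℕ.+ suc P

  -- Above `P`, the cost is at least `height - P - 1`.
  φ≤H⇒height≤B₀ : ∀ c → φ c ℤ.≤ + H → height c ≤ B₀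
  φ≤H⇒height≤B₀ c φ≤H with height c ℕ.≤? P
  ... | yes e≤P = ℕ.≤-trans e≤P (ℕ.≤-trans (ℕ.n≤1+n P) (ℕ.m≤n+m (suc P) H))
  ... | no  e≰P = ℤ.drop‿+≤+ (ℤ.≤-trans (≤-by-difference surplus≤φ (identity (φ c) (+ height c) (+ P)))
                    (ℤ.+-monoˡ-≤ (+ suc P) φ≤H))
    where
    0≤surplus : 0ℤ ℤ.≤ surplus c
    0≤surplus = ℤ.≤-trans (ℤ.i≤j⇒0≤j-i (ℤ.+≤+ (ℕ.<⇒≤ (ℕ.≰⇒> e≰P)))) (height-P≤surplus c)
    1≤L : 1ℤ ℤ.≤ + L
    1≤L = ℤ.+≤+ (s≤s z≤n)
    surplus≤φ : (+ height c ℤ.- + P) ℤ.- 1ℤ ℤ.≤ φ c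
    surplus≤φ = ℤ.+-monoˡ-≤ (ℤ.- 1ℤ) (begin
      + height c ℤ.- + P     ≤⟨ height-P≤surplus c ⟩
      surplus c              ≡⟨ ℤ.*-identityˡ (surplus c) ⟨
      1ℤ ℤ.* surplus c       ≤⟨ ℤ.*-monoʳ-≤-nonNeg (surplus c) {{ℤ.nonNegative 0≤surplus}} 1≤L ⟩
      + L ℤ.* surplus c      ∎)
      where open ℤ.≤-Reasoning
    identity : ∀ φ e P → (φ ℤ.+ (1ℤ ℤ.+ P)) ℤ.- e ≡ φ ℤ.- ((e ℤ.- P) ℤ.- 1ℤ)
    identity = ℤ-Solver.solve-∀

  record Lasso (u : Config) : Set where
    field
      {knot}       : Config
      {stem loop}  : List Config
      stem-walk    : Walk u stem knot
      loop-walk    : Walk knot (loop ++ knot ∷ []) knot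
      loop-surplus : cost surplus (loop ++ knot ∷ []) ℤ.≤ 0ℤ
      stem-length  : length stem ≤ walkBound B₀
      loop-length  : length (loop ++ knot ∷ []) ≤ K ℕ.* (2 ℕ.+ P)

  open LoopErasure _≟_ φ using (CheapCycle; erase)

  -- The rest of the cycle costs at least `- H`, so `w` costs at most `H` and is no higher than
  -- `B₀`. Hence the walk to it can be shortened.
  cheapCycle⇒lasso : ∀ {u} → height u ≡ 0 → CheapCycle u → Lasso u
  cheapCycle⇒lasso {u} e≡0 (w , ys , zs , p , c , unique , c≤0) = record
    { stem-walk = proj₁ (proj₂ short) ; loop-walk = c
    ; loop-surplus = cheap⇒surplus≤0 unique c≤0
    ; stem-length = proj₂ (proj₂ short)
    ; loop-length = cheap⇒length≤ unique c≤0 }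
    where
    φw≤H : φ w ℤ.≤ + H
    φw≤H = ≤-by-difference (ℤ.+-mono-≤ (-H≤cost (proj₁ (Unique-++⁻ ys unique)))
        (subst (ℤ._≤ 0ℤ) (cost-++ φ ys (w ∷ [])) c≤0))
      (identity (φ w) (cost φ ys) (+ H))
      where
      identity : ∀ x y H → H ℤ.- x ≡ (y ℤ.+ 0ℤ) ℤ.- (ℤ.- H ℤ.+ (y ℤ.+ (x ℤ.+ 0ℤ)))
      identity = ℤ-Solver.solve-∀
    short = shorten B₀ p (<-wellFounded _) (subst (_≤ B₀) (sym e≡0) z≤n) (φ≤H⇒height≤B₀ w φw≤H)

  module _ (c : ℕ → Config) (c-step : ∀ n → R (c n) (c (suc n))) where

    visited : ℕ → List Config
    visited zero    = []
    visited (suc n) = c n ∷ visited n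

    visited-walk : ∀ n → Walk (c 0) (visited n) (c n)
    visited-walk zero    = []
    visited-walk (suc n) = visited-walk n ▷ c-step n

    length-visited : ∀ n → length (visited n) ≡ n
    length-visited zero    = refl
    length-visited (suc n) = cong suc (length-visited n)

    -- Otherwise loop erasure would leave a simple walk that costs less than `- H`.
    negative-cost⇒cheapCycle : ∀ n → cost φ (visited n) ℤ.< ℤ.- + H → CheapCycle (c 0)
    negative-cost⇒cheapCycle n cost< with erase (visited-walk n)
    ... | inj₁ cycle = cycle
    ... | inj₂ (vs , _ , (_ ∷ unique) , _ , cost≤) =
      contradiction (ℤ.≤-<-trans (ℤ.≤-trans (-H≤cost unique) cost≤) cost<) (ℤ.<-irrefl refl)

    -- `visited (2 + n)` covers the levels 0 to `n + 1`. Adding `↥ t` cancels the surplus of the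
    -- initial level 0, which the averages leave out.
    play⇒lasso : height (c 0) ≡ 0 →
      (∀ m-1 → ∃[ N ] ∀ n → N ≤ n →
        + suc m-1 ℤ.* (cost surplus (visited (2 ℕ.+ n)) ℤ.+ ↥ t) ℤ.≤ + suc n) →
      Lasso (c 0)
    -- The argument is the predecessor of `2 * L`.
    play⇒lasso e≡0 small = from-drift (small (M ℕ.+ suc (M ℕ.+ 0)))
      where
      from-drift : (∃[ N ] ∀ n → N ≤ n →
        + (2 ℕ.* L) ℤ.* (cost surplus (visited (2 ℕ.+ n)) ℤ.+ ↥ t) ℤ.≤ + suc n) → Lasso (c 0)
      from-drift (N , small) = cheapCycle⇒lasso e≡0 (negative-cost⇒cheapCycle (2 ℕ.+ n) (subst (ℤ._< ℤ.- + H)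
        (sym (trans (cost-φ (visited (2 ℕ.+ n)))
                    (cong (λ m → + L ℤ.* cost surplus (visited (2 ℕ.+ n)) ℤ.- + m) (length-visited (2 ℕ.+ n)))))
        (drift⇒cost< L P H N (cost surplus (visited (2 ℕ.+ n))) (↥ t) (-∣i∣≤i (↥ t)) (small n (ℕ.m≤m+n N _)))))
        where
        n = N ℕ.+ 2 ℕ.* (L ℕ.* P ℕ.+ H)

-- Strategies following a lasso

module Games (G : Game) where
  open Game G

  ∈-states : ∀ s → s ∈ states
  ∈-states (one , k) = ∈-++⁺ˡ (∈-map⁺ (one ,_) (∈-allFin k))
  ∈-states (two , k) = ∈-++⁺ʳ (map (one ,_) _) (∈-map⁺ (two ,_) (∈-allFin k))

  idx : State → Fin (length states)
  idx s = Any.index (∈-states s)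

  lookup-idx : ∀ s → lookup states (idx s) ≡ s
  lookup-idx s = sym (Any.lookup-index (∈-states s))

  idx-injective : ∀ {s s′} → idx s ≡ idx s′ → s ≡ s′
  idx-injective {s} {s′} eq = trans (sym (lookup-idx s)) (trans (cong (lookup states) eq) (lookup-idx s′))

  infix 4 _≟ₛ_
  _≟ₛ_ : DecidableEquality State
  s ≟ₛ s′ = map′ idx-injective (cong idx) (idx s Fin.≟ idx s′)

  weight-cong : ∀ {s₁ s₂ s₁′ s₂′} {h₁ : T (edge s₁ s₁′)} {h₂ : T (edge s₂ s₂′)} →
    s₁ ≡ s₂ → s₁′ ≡ s₂′ → weight (s₁ , s₁′ , h₁) ≡ weight (s₂ , s₂′ , h₂)
  weight-cong {h₁ = h₁} {h₂} refl refl = cong (λ h → weight (_ , _ , h)) (T-irrelevant h₁ h₂)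

  ∈-edges : ∀ e → e ∈ edges
  ∈-edges (s , s′ , h) = Any.mapMaybe⁺ _ (cartesianProduct states states)
    (Any.map⁺ (Any.map (λ { refl → found }) (∈-cartesianProduct⁺ (∈-states s) (∈-states s′))))
    where
    T?-yes : ∀ b (h : T b) → dec⇒maybe (T? b) ≡ just h
    T?-yes true h = refl
    found : MAny.Any ((s , s′ , h) ≡_) (Maybe.map (λ e → s , s′ , e) (dec⇒maybe (T? (edge s s′))))
    found = subst (λ x → MAny.Any ((s , s′ , h) ≡_) (Maybe.map (λ e → s , s′ , e) x))
      (sym (T?-yes (edge s s′) h)) (MAny.just refl)

  ∣weight∣≤maxWeight : ∀ e → ∣ weight e ∣ ≤ maxWeight
  ∣weight∣≤maxWeight e = All.lookup (xs≤max 0 (map (λ e → ∣ weight e ∣) edges)) (∈-map⁺ (λ e → ∣ weight e ∣) (∈-edges e))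

  infix 4 _⟶_
  -- Heights are natural numbers, so walks in this graph respect the energy objective by
  -- construction.
  _⟶_ : State × ℕ → State × ℕ → Set
  (s , e) ⟶ (s′ , e′) = Σ[ h ∈ T (edge s s′) ] + e′ ≡ + e ℤ.+ weight (s , s′ , h)

  ⟶-lower : ∀ {s e s′ e′} d → (s , e ℕ.+ d) ⟶ (s′ , e′ ℕ.+ d) → (s , e) ⟶ (s′ , e′)
  ⟶-lower {s} {e} {s′} {e′} d (h , eq) = h , (begin
    + e′                                        ≡⟨ identity₁ (+ e′) (+ d) ⟩
    (+ e′ ℤ.+ + d) ℤ.- + d                      ≡⟨ cong (ℤ._- + d) eq ⟩
    ((+ e ℤ.+ + d) ℤ.+ weight (s , s′ , h)) ℤ.- + d ≡⟨ identity₂ (+ e) (+ d) (weight (s , s′ , h)) ⟩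
    + e ℤ.+ weight (s , s′ , h)                 ∎)
    where
    open ≡-Reasoning
    identity₁ : ∀ x d → x ≡ (x ℤ.+ d) ℤ.- d
    identity₁ = ℤ-Solver.solve-∀
    identity₂ : ∀ x d w → ((x ℤ.+ d) ℤ.+ w) ℤ.- d ≡ x ℤ.+ w
    identity₂ = ℤ-Solver.solve-∀

  ⟶-rise : ∀ {s e s′ e′} → (s , e) ⟶ (s′ , e′) → e′ ≤ e ℕ.+ maxWeight
  ⟶-rise {s} {e} {s′} {e′} (h , eq) = ℤ.drop‿+≤+ (begin
    + e′                                        ≡⟨ eq ⟩
    + e ℤ.+ weight (s , s′ , h)                 ≤⟨ ℤ.+-monoʳ-≤ (+ e) (i≤∣i∣ (weight (s , s′ , h))) ⟩
    + e ℤ.+ + ∣ weight (s , s′ , h) ∣           ≤⟨ ℤ.+-monoʳ-≤ (+ e) (ℤ.+≤+ (∣weight∣≤maxWeight (s , s′ , h))) ⟩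
    + e ℤ.+ + maxWeight                         ∎)
    where open ℤ.≤-Reasoning

  ⟶-fall : ∀ {s e s′ e′} → (s , e) ⟶ (s′ , e′) → e ≤ e′ ℕ.+ maxWeight
  ⟶-fall {s} {e} {s′} {e′} (h , eq) = ℤ.drop‿+≤+ (≤-by-difference
    (ℤ.≤-trans (ℤ.neg-mono-≤ (ℤ.+≤+ (∣weight∣≤maxWeight (s , s′ , h)))) (-∣i∣≤i (weight (s , s′ , h))))
    (trans (cong (λ i → (i ℤ.+ + maxWeight) ℤ.- + e) eq) (identity (+ e) (weight (s , s′ , h)) (+ maxWeight))))
    where
    identity : ∀ e w W → ((e ℤ.+ w) ℤ.+ W) ℤ.- e ≡ w ℤ.- (ℤ.- W)
    identity = ℤ-Solver.solve-∀

prefixSum : (ℕ → ℤ) → ℕ → ℤ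
prefixSum g zero    = 0ℤ
prefixSum g (suc k) = prefixSum g k ℤ.+ g k

prefixSum-suc : ∀ g k → prefixSum g (suc k) ≡ g 0 ℤ.+ prefixSum (g ∘ suc) k
prefixSum-suc g zero    = trans (ℤ.+-identityˡ (g 0)) (sym (ℤ.+-identityʳ (g 0)))
prefixSum-suc g (suc k) = trans (cong (ℤ._+ g (suc k)) (prefixSum-suc g k)) (ℤ.+-assoc (g 0) _ _)

prefixSum-lower : ∀ g P → (∀ i → ℤ.- + P ℤ.≤ g i) → ∀ {k m} → k ≤ m → ℤ.- + (m ℕ.* P) ℤ.≤ prefixSum g k
prefixSum-lower g P -P≤g {zero}  {m} _ = ℤ.neg-mono-≤ (ℤ.+≤+ z≤n)
prefixSum-lower g P -P≤g {suc k} {suc m} (s≤s k≤m) = ≤-by-difference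
  (ℤ.+-mono-≤ (prefixSum-lower g P -P≤g k≤m) (-P≤g k))
  (identity (prefixSum g k) (g k) (+ (m ℕ.* P)) (+ P))
  where
  identity : ∀ x y a P → (x ℤ.+ y) ℤ.- (ℤ.- (P ℤ.+ a)) ≡ (x ℤ.+ y) ℤ.- (ℤ.- a ℤ.+ ℤ.- P)
  identity = ℤ-Solver.solve-∀

rewind : ∀ {m} → Fin m → Fin m → Fin m
rewind back zero    = back
rewind back (suc r) = inject₁ r

toℕ-rewind : ∀ {m} (back : Fin m) r {k} → toℕ r ≡ suc k → toℕ (rewind back r) ≡ k
toℕ-rewind back (suc r) eq = trans (Fin.toℕ-inject₁ r) (ℕ.suc-injective eq)

toℕ-rewind-zero : ∀ {m} (back : Fin m) r → toℕ r ≡ 0 → rewind back r ≡ back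
toℕ-rewind-zero back zero eq = refl

-- The bounds on loop and stem of a lasso, `K * (2 + P)` and `walkBound B₀`, as a polynomial in the
-- number of states `s`, the largest weight `w` and the numerator `p`.
memoryBound : Poly 5
memoryBound = (K ⊗ (con 2 ⊕ p)) ⊕ (s ⊗ (con 1 ⊕ ((H ⊕ (con 1 ⊕ p)) ⊕ ((s ⊗ w) ⊗ (s ⊗ w)))))
  where
  s w p K M H : Poly 5
  s = var zero
  w = var (suc (suc zero))
  p = var (suc (suc (suc zero)))
  K = s ⊗ (con 1 ⊕ p)
  M = con 1 ⊕ ((K ⊗ (con 2 ⊕ p)) ⊕ p)
  H = M ⊗ (K ⊗ (con 2 ⊕ p))

module OnePlayer (I : Instance) (S₂=∅ : Instance.size I two ≡ 0) where
  open Instance I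
  open Games game
  open Lassos idx idx-injective _⟶_ maxWeight ⟶-lower ⟶-rise ⟶-fall threshold

  fin₂-elim : ∀ {ℓ} {A : Set ℓ} → Fin (size two) → A
  fin₂-elim k with () ← subst Fin S₂=∅ k

  τ∅ : Strategy game two
  τ∅ s₀ k = fin₂-elim k

  t = threshold

  module _ (π : Play game) (energy : EnergyL game 0 π) (average : AvgEnergy game t π) where
    open Play π renaming (at to atπ)

    0≤EL : ∀ n → 0ℤ ℤ.≤ EL game π n
    0≤EL n = subst (0ℤ ℤ.≤_) (ℤ.+-identityˡ _) (energy n)

    config : ℕ → Config
    config n = atπ n , ∣ EL game π n ∣

    config-step : ∀ n → config n ⟶ config (suc n)
    config-step n = step n , trans (ℤ.0≤i⇒+∣i∣≡i (0≤EL (suc n)))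
      (cong (ℤ._+ weight (atπ n , atπ (suc n) , step n)) (sym (ℤ.0≤i⇒+∣i∣≡i (0≤EL n))))

    surplus-visited : ∀ n → cost surplus (visited config config-step (suc n)) ℤ.+ ↥ t
      ≡ ↧ t ℤ.* sumEL game π n ℤ.- ↥ t ℤ.* + n
    surplus-visited zero    = identity (↧ t) (↥ t)
      where
      identity : ∀ q p → ((q ℤ.* 0ℤ ℤ.- p) ℤ.+ 0ℤ) ℤ.+ p ≡ q ℤ.* 0ℤ ℤ.- p ℤ.* 0ℤ
      identity = ℤ-Solver.solve-∀
    surplus-visited (suc n) = begin
      surplus (config (suc n)) ℤ.+ c ℤ.+ ↥ t
        ≡⟨ ℤ.+-assoc (surplus (config (suc n))) c (↥ t) ⟩
      surplus (config (suc n)) ℤ.+ (c ℤ.+ ↥ t)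
        ≡⟨ cong₂ (λ e x → (↧ t ℤ.* e ℤ.- ↥ t) ℤ.+ x) (ℤ.0≤i⇒+∣i∣≡i (0≤EL (suc n))) (surplus-visited n) ⟩
      (↧ t ℤ.* EL game π (suc n) ℤ.- ↥ t) ℤ.+ (↧ t ℤ.* sumEL game π n ℤ.- ↥ t ℤ.* + n)
        ≡⟨ identity (↧ t) (↥ t) (EL game π (suc n)) (sumEL game π n) (+ n) ⟩
      ↧ t ℤ.* sumEL game π (suc n) ℤ.- ↥ t ℤ.* + suc n ∎
      where
      open ≡-Reasoning
      c = cost surplus (visited config config-step (suc n))
      identity : ∀ q p e s n → (q ℤ.* e ℤ.- p) ℤ.+ (q ℤ.* s ℤ.- p ℤ.* n) ≡ q ℤ.* (s ℤ.+ e) ℤ.- p ℤ.* (1ℤ ℤ.+ n)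
      identity = ℤ-Solver.solve-∀

    AEL⇒lasso : Lasso (config 0)
    AEL⇒lasso = play⇒lasso config config-step refl λ m-1 →
      let N , small = limsup≤⇒small-excess t (sumEL game π ∘ suc) average m-1
      in N , λ n N≤n → subst (λ x → + suc m-1 ℤ.* x ℤ.≤ + suc n) (sym (surplus-visited (suc n))) (small n N≤n)

  module _ (lasso : Lasso (init , 0)) where
    open Lasso lasso

    m : ℕ
    m = length ((loop ++ knot ∷ []) ++ stem)

    walk : Walk (init , 0) ((loop ++ knot ∷ []) ++ stem) knot
    walk = stem-walk ∙ loop-walk

    ∣loop∣>0 : length (loop ++ knot ∷ []) ≡ suc (length loop)
    ∣loop∣>0 = trans (List.length-++ loop) (ℕ.+-comm (length loop) 1)

    loop<m : length loop < m
    loop<m = ℕ.≤-trans (ℕ.≤-reflexive (sym ∣loop∣>0))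
      (ℕ.≤-trans (ℕ.m≤m+n _ (length stem)) (ℕ.≤-reflexive (sym (List.length-++ (loop ++ knot ∷ [])))))

    -- At the start of the loop `length loop + 1` steps are left, at the start of the lasso `m`; the
    -- memory is one less.
    back : Fin m
    back = fromℕ< loop<m

    fore : Fin m
    fore = fromℕ< (ℕ.≤-reflexive (ℕ.suc-pred m {{ℕ.>-nonZero (ℕ.≤-<-trans z≤n loop<m)}}))

    y : ℕ → Config
    y i = at walk (suc i)

    -- Memory r stands for the configuration with r + 1 steps left to the end
    -- of the lasso.
    Y : Fin m → Config
    Y r = y (toℕ r)

    Y-fore : Y fore ≡ (init , 0)
    Y-fore = trans (cong (at walk) (trans (cong suc (Fin.toℕ-fromℕ< _))
      (ℕ.suc-pred m {{ℕ.>-nonZero (ℕ.≤-<-trans z≤n loop<m)}})))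
      (at-start walk)

    Y-back : Y back ≡ knot
    Y-back = trans (cong (at walk) (trans (cong suc (Fin.toℕ-fromℕ< loop<m)) (sym ∣loop∣>0)))
      (at-∙ stem-walk loop-walk)

    Y-step : ∀ r → Y r ⟶ Y (rewind back r)
    Y-step r = by-cases (toℕ r) refl
      where
      by-cases : ∀ k → toℕ r ≡ k → Y r ⟶ Y (rewind back r)
      -- The last step arrives at the knot, which is also where the loop starts.
      by-cases zero    eq = subst₂ _⟶_ (cong y (sym eq))
        (trans (sym Y-back) (cong Y (sym (toℕ-rewind-zero back r eq)))) (at-step walk 0 (ℕ.≤-<-trans z≤n loop<m))
      by-cases (suc k) eq = subst₂ _⟶_ (cong y (sym eq)) (cong y (sym (toℕ-rewind back r eq)))
        (at-step walk (suc k) (subst (_< m) eq (Fin.toℕ<n r)))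

    -- A potential: the surplus of the positions from the current one, included, to the end of the
    -- lasso.
    Ψ : Fin m → ℤ
    Ψ r = prefixSum (surplus ∘ y) (suc (toℕ r))

    prefixSum-loop : ∀ {u us v vs w} (p : Walk u us v) (q : Walk v vs w) →
      prefixSum (λ i → surplus (at (p ∙ q) (suc i))) (length vs) ≡ cost surplus vs
    prefixSum-loop p []      = refl
    prefixSum-loop p (_▷_ {us = vs} {v = v} q r) = trans
      (prefixSum-suc (λ i → surplus (at (p ∙ (q ▷ r)) (suc i))) (length vs))
      (cong (ℤ._+_ (surplus v)) (prefixSum-loop p q))

    Ψ-back≤0 : Ψ back ℤ.≤ 0ℤ
    Ψ-back≤0 = subst (ℤ._≤ 0ℤ) (trans (sym (prefixSum-loop stem-walk loop-walk))
      (cong (prefixSum (surplus ∘ y)) (trans ∣loop∣>0 (cong suc (sym (Fin.toℕ-fromℕ< loop<m)))))) loop-surplus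

    Ψ-step : ∀ r → surplus (Y r) ℤ.+ Ψ (rewind back r) ℤ.≤ Ψ r
    Ψ-step r = by-cases (toℕ r) refl
      where
      open ℤ.≤-Reasoning
      by-cases : ∀ k → toℕ r ≡ k → surplus (Y r) ℤ.+ Ψ (rewind back r) ℤ.≤ Ψ r
      -- Restarting the loop resets the potential to the surplus of the whole loop, which is
      -- nonpositive.
      by-cases zero eq = begin
        surplus (Y r) ℤ.+ Ψ (rewind back r)     ≡⟨ cong (λ r′ → surplus (Y r) ℤ.+ Ψ r′) (toℕ-rewind-zero back r eq) ⟩
        surplus (Y r) ℤ.+ Ψ back                ≤⟨ ℤ.+-monoʳ-≤ (surplus (Y r)) Ψ-back≤0 ⟩
        surplus (Y r) ℤ.+ 0ℤ                    ≡⟨ ℤ.+-comm (surplus (Y r)) 0ℤ ⟩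
        0ℤ ℤ.+ surplus (Y r)                    ≡⟨ cong (λ k → prefixSum (surplus ∘ y) k ℤ.+ surplus (Y r)) eq ⟨
        Ψ r                                     ∎
      by-cases (suc k) eq = begin
        surplus (Y r) ℤ.+ Ψ (rewind back r)     ≡⟨ ℤ.+-comm (surplus (Y r)) _ ⟩
        Ψ (rewind back r) ℤ.+ surplus (Y r)     ≡⟨ cong (λ k → prefixSum (surplus ∘ y) k ℤ.+ surplus (Y r))
                                                     (trans (cong suc (toℕ-rewind back r eq)) (sym eq)) ⟩
        Ψ r                                     ∎

    Ψ-lower : ∀ r → ℤ.- + (m ℕ.* P) ℤ.≤ Ψ r
    Ψ-lower r = prefixSum-lower (surplus ∘ y) P (λ i → -P≤surplus (y i)) (Fin.toℕ<n r)

    -- States that disagree with the lasso are never met by the outcome; `total` supplies a default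
    -- move there.
    follow : ∀ r k → Dec (proj₁ (Y r) ≡ (one , k)) → Successor (one , k)
    follow r k (yes eq) = proj₁ (Y (rewind back r)) ,
      subst (λ s → T (edge s (proj₁ (Y (rewind back r))))) eq (proj₁ (Y-step r))
    follow r k (no _)   = total (one , k)

    follow-≡ : ∀ r k d → proj₁ (Y r) ≡ (one , k) → proj₁ (follow r k d) ≡ proj₁ (Y (rewind back r))
    follow-≡ r k (yes _) eq = refl
    follow-≡ r k (no ≢)  eq = contradiction eq ≢

    machine : Moore game one m
    machine = record
      { initial = fore
      ; update  = λ r _ → rewind back r
      ; next    = λ r k → follow r k (proj₁ (Y r) ≟ₛ (one , k))
      }

    σ : Strategy game one
    σ = Moore.strategy machine

    module _ (τ : Strategy game two) where
      π : Play game
      π = outcome game σ τ init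

      history : ∀ n → Prefix game init (Play.at π n)
      history n = proj₂ (prefix game σ τ init n)

      μ : ℕ → Fin m
      μ n = Moore.memory machine (history n)

      move-≡ : ∀ s (h : Prefix game init s) → s ≡ proj₁ (Y (Moore.memory machine h)) →
        proj₁ (move game σ τ init s h) ≡ proj₁ (Y (rewind back (Moore.memory machine h)))
      move-≡ (one , k) h eq = follow-≡ r k (proj₁ (Y r) ≟ₛ (one , k)) (sym eq)
        where r = Moore.memory machine h
      move-≡ (two , k) h eq = fin₂-elim k

      at≡Y : ∀ n → Play.at π n ≡ proj₁ (Y (μ n))
      at≡Y zero    = cong proj₁ (sym Y-fore)
      at≡Y (suc n) = move-≡ (Play.at π n) (history n) (at≡Y n)

      EL≡Y : ∀ n → EL game π n ≡ + height (Y (μ n))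
      EL≡Y zero    = cong (+_ ∘ height) (sym Y-fore)
      EL≡Y (suc n) = trans (cong₂ ℤ._+_ (EL≡Y n) (weight-cong {h₁ = Play.step π n} {h₂ = proj₁ (Y-step (μ n))} (at≡Y n) (at≡Y (suc n))))
        (sym (proj₂ (Y-step (μ n))))

      -- Amortisation: the surplus collected so far, with `- ↥ t` for the initial level, plus the
      -- remaining potential never exceeds the initial potential.
      excess≤ : ∀ n → ↧ t ℤ.* sumEL game π n ℤ.- ↥ t ℤ.* + n ℤ.- ↥ t ℤ.+ Ψ (rewind back (μ n)) ℤ.≤ Ψ fore
      excess≤ zero    = ≤-by-difference (Ψ-step fore) (cong (λ x → Ψ fore ℤ.- x)
        (trans (identity (↧ t) (↥ t) (Ψ (rewind back fore)))
          (cong (λ e → (↧ t ℤ.* + e ℤ.- ↥ t) ℤ.+ Ψ (rewind back fore)) (cong height (sym Y-fore)))))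
        where
        identity : ∀ q p x → q ℤ.* 0ℤ ℤ.- p ℤ.* 0ℤ ℤ.- p ℤ.+ x ≡ (q ℤ.* 0ℤ ℤ.- p) ℤ.+ x
        identity = ℤ-Solver.solve-∀
      excess≤ (suc n) = ≤-by-difference (ℤ.+-mono-≤ (excess≤ n) (Ψ-step (μ (suc n))))
        (trans (cong (λ e → Ψ fore ℤ.-
                 (↧ t ℤ.* (sumEL game π n ℤ.+ e) ℤ.- ↥ t ℤ.* + suc n ℤ.- ↥ t ℤ.+ Ψ (rewind back (μ (suc n))))) (EL≡Y (suc n)))
          (identity (↧ t) (↥ t) (Ψ (rewind back (μ (suc n)))) (Ψ (rewind back (μ n))) (Ψ fore)
            (sumEL game π n) (+ height (Y (μ (suc n)))) (+ n)))
        where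
        identity : ∀ q p x z f s e n →
          f ℤ.- (q ℤ.* (s ℤ.+ e) ℤ.- p ℤ.* (1ℤ ℤ.+ n) ℤ.- p ℤ.+ x)
          ≡ (f ℤ.+ z) ℤ.- ((q ℤ.* s ℤ.- p ℤ.* n ℤ.- p ℤ.+ z) ℤ.+ ((q ℤ.* e ℤ.- p) ℤ.+ x))
        identity = ℤ-Solver.solve-∀

      bound : ∀ n → excess t (sumEL game π ∘ suc) n ℤ.≤ + (∣ Ψ fore ∣ ℕ.+ P ℕ.+ m ℕ.* P)
      bound n = ≤-by-difference
        (ℤ.+-mono-≤ (ℤ.+-mono-≤ (excess≤ (suc n)) (Ψ-lower (rewind back (μ (suc n)))))
                    (ℤ.+-mono-≤ (i≤∣i∣ (Ψ fore)) (i≤∣i∣ (↥ t))))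
        (identity (excess t (sumEL game π ∘ suc) n) (↥ t) (Ψ (rewind back (μ (suc n)))) (Ψ fore)
          (+ ∣ Ψ fore ∣) (+ P) (+ (m ℕ.* P)))
        where
        identity : ∀ e p x f F P Q → ((F ℤ.+ P) ℤ.+ Q) ℤ.- e ≡
          ((f ℤ.+ x) ℤ.+ (F ℤ.+ P)) ℤ.- (((e ℤ.- p ℤ.+ x) ℤ.+ (ℤ.- Q)) ℤ.+ (f ℤ.+ p))
        identity = ℤ-Solver.solve-∀

      lasso-wins : AEL π
      lasso-wins =
        (λ n → subst (0ℤ ℤ.≤_) (sym (trans (ℤ.+-identityˡ _) (EL≡Y n))) (ℤ.+≤+ z≤n)) ,
        bounded-excess⇒limsup≤ t (sumEL game π ∘ suc) _ bound

    lasso⇒memory : ∃[ σ ] Wins₁ σ × (∃[ m ] HasMemory game σ m ×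
      m ≤ ⟦ memoryBound ⟧ (∣S∣ ∷ ∣E∣ ∷ maxWeight ∷ ∣num∣ ∷ den ∷ []))
    lasso⇒memory = σ , lasso-wins , m , (machine , λ _ _ _ → refl) ,
      ℕ.≤-trans (ℕ.≤-reflexive (List.length-++ (loop ++ knot ∷ []))) (ℕ.+-mono-≤ loop-length stem-length)

-- Memoryless strategies of player 2

bounded : ∀ {n} (g : Fin n → ℤ) → ∃[ C ] ∀ i → g i ℤ.≤ + C
bounded {zero}  g = 0 , λ ()
bounded {suc n} g with bounded (g ∘ suc)
... | C , g≤C = ∣ g zero ∣ ℕ.+ C , λ where
  zero    → ℤ.≤-trans (i≤∣i∣ (g zero)) (ℤ.+≤+ (ℕ.m≤m+n _ C))
  (suc i) → ℤ.≤-trans (g≤C i) (ℤ.+≤+ (ℕ.m≤n+m C ∣ g zero ∣))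

periodic-growth : ∀ (g : ℕ → ℤ) a k i₀ →
  (∀ i → i₀ ≤ i → g (i ℕ.+ a) ℤ.+ 1ℤ ℤ.≤ g (i ℕ.+ (k ℕ.+ a))) →
  ∀ j → g (i₀ ℕ.+ a) ℤ.+ + j ℤ.≤ g ((j ℕ.* k ℕ.+ i₀) ℕ.+ a)
periodic-growth g a k i₀ grows zero    = ℤ.≤-reflexive (ℤ.+-identityʳ _)
periodic-growth g a k i₀ grows (suc j) = begin
  g (i₀ ℕ.+ a) ℤ.+ (1ℤ ℤ.+ + j)                 ≡⟨ identity (g (i₀ ℕ.+ a)) (+ j) ⟩
  (g (i₀ ℕ.+ a) ℤ.+ + j) ℤ.+ 1ℤ                 ≤⟨ ℤ.+-monoˡ-≤ 1ℤ (periodic-growth g a k i₀ grows j) ⟩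
  g ((j ℕ.* k ℕ.+ i₀) ℕ.+ a) ℤ.+ 1ℤ             ≤⟨ grows (j ℕ.* k ℕ.+ i₀) (ℕ.m≤n+m i₀ (j ℕ.* k)) ⟩
  g ((j ℕ.* k ℕ.+ i₀) ℕ.+ (k ℕ.+ a))            ≡⟨ cong g (index (j ℕ.* k) i₀ k a) ⟩
  g ((k ℕ.+ j ℕ.* k ℕ.+ i₀) ℕ.+ a)              ∎
  where
  open ℤ.≤-Reasoning
  identity : ∀ x j → x ℤ.+ (1ℤ ℤ.+ j) ≡ (x ℤ.+ j) ℤ.+ 1ℤ
  identity = ℤ-Solver.solve-∀
  index : ∀ jk i k a → (jk ℕ.+ i) ℕ.+ (k ℕ.+ a) ≡ (k ℕ.+ jk ℕ.+ i) ℕ.+ a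
  index = ℕ-Solver.solve-∀

-- A growth rate of `1 / k` contradicts one of at most `1 / (2 k)`; `j` is large enough to pass `N`
-- and to absorb the constants `o` and `x`.
linear-growth⇒⊥ : ∀ (g : ℕ → ℤ) (k-1 o N : ℕ) (x : ℤ) → let k = suc k-1 in
  (∀ j → x ℤ.+ + j ℤ.≤ g (j ℕ.* k ℕ.+ o)) →
  (∀ n → N < n → + (2 ℕ.* k) ℤ.* g n ℤ.≤ + n) → ⊥
linear-growth⇒⊥ g k-1 o N x grows small = ℕ.<-irrefl refl (ℕ.<-≤-trans j-large (ℤ.drop‿+≤+ j-small))
  where
  k = suc k-1
  c = o ℕ.+ 2 ℕ.* k ℕ.* ∣ x ∣
  j = suc (N ℕ.+ c)
  n = j ℕ.* k ℕ.+ o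
  j-large : c < j ℕ.* k
  j-large = ℕ.<-≤-trans (s≤s (ℕ.m≤n+m c N)) (ℕ.m≤m*n j k)
  N<n : N < n
  N<n = ℕ.<-≤-trans (s≤s (ℕ.m≤m+n N c)) (ℕ.≤-trans (ℕ.m≤m*n j k) (ℕ.m≤m+n _ o))
  identity : ∀ o k x X j → (o ℤ.+ + 2 ℤ.* k ℤ.* X) ℤ.- j ℤ.* k ≡
    ((j ℤ.* k ℤ.+ o) ℤ.+ + 2 ℤ.* k ℤ.* x) ℤ.- (+ 2 ℤ.* k ℤ.* (x ℤ.+ j) ℤ.+ + 2 ℤ.* k ℤ.* (ℤ.- X))
  identity = ℤ-Solver.solve-∀
  2k≡ : + (2 ℕ.* k) ≡ + 2 ℤ.* + k
  2k≡ = ℤ.pos-* 2 k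
  j-small : + (j ℕ.* k) ℤ.≤ + c
  j-small = ≤-by-difference
    (ℤ.+-mono-≤ (ℤ.≤-trans (ℤ.*-monoˡ-≤-nonNeg (+ (2 ℕ.* k)) (grows j)) (small n N<n))
                (ℤ.*-monoˡ-≤-nonNeg (+ (2 ℕ.* k)) (-∣i∣≤i x)))
    (begin
      + c ℤ.- + (j ℕ.* k)
        ≡⟨ cong₂ (λ y z → (+ o ℤ.+ y) ℤ.- z) (trans (ℤ.pos-* (2 ℕ.* k) ∣ x ∣) (cong (ℤ._* + ∣ x ∣) 2k≡)) (ℤ.pos-* j k) ⟩
      (+ o ℤ.+ + 2 ℤ.* + k ℤ.* + ∣ x ∣) ℤ.- + j ℤ.* + k
        ≡⟨ identity (+ o) (+ k) x (+ ∣ x ∣) (+ j) ⟩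
      ((+ j ℤ.* + k ℤ.+ + o) ℤ.+ + 2 ℤ.* + k ℤ.* x) ℤ.- (+ 2 ℤ.* + k ℤ.* (x ℤ.+ + j) ℤ.+ + 2 ℤ.* + k ℤ.* (ℤ.- + ∣ x ∣))
        ≡⟨ cong₂ (λ y z → ((y ℤ.+ + o) ℤ.+ z ℤ.* x) ℤ.- (z ℤ.* (x ℤ.+ + j) ℤ.+ z ℤ.* (ℤ.- + ∣ x ∣))) (ℤ.pos-* j k) 2k≡ ⟨
      (+ n ℤ.+ + (2 ℕ.* k) ℤ.* x) ℤ.- (+ (2 ℕ.* k) ℤ.* (x ℤ.+ + j) ℤ.+ + (2 ℕ.* k) ℤ.* (ℤ.- + ∣ x ∣)) ∎)
    where open ≡-Reasoning

-- Ultimately periodic plays that violate the objective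

module Excesses (G : Game) (t : ℚ) where
  open Game G
  open Games G

  -- The accumulated surplus of the first `n` levels, that is `excess` with the index shifted by
  -- one.
  excessAt : Play G → ℕ → ℤ
  excessAt π n = ↧ t ℤ.* sumEL G π n ℤ.- ↥ t ℤ.* + n

  excessAt-suc : ∀ π n → excessAt π (suc n) ≡ excessAt π n ℤ.+ (↧ t ℤ.* EL G π (suc n) ℤ.- ↥ t)
  excessAt-suc π n = identity (↧ t) (↥ t) (sumEL G π n) (EL G π (suc n)) (+ n)
    where
    identity : ∀ q p s e n → q ℤ.* (s ℤ.+ e) ℤ.- p ℤ.* (1ℤ ℤ.+ n) ≡ (q ℤ.* s ℤ.- p ℤ.* n) ℤ.+ (q ℤ.* e ℤ.- p)
    identity = ℤ-Solver.solve-∀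

  module _ (π π′ : Play G) (k : ℕ) (at≡ : ∀ {j} → j ≤ k → Play.at π j ≡ Play.at π′ j) where

    EL-cong : ∀ {j} → j ≤ k → EL G π j ≡ EL G π′ j
    EL-cong {zero}  _   = refl
    EL-cong {suc j} j<k = cong₂ ℤ._+_ (EL-cong (ℕ.<⇒≤ j<k))
      (weight-cong {h₁ = Play.step π j} {h₂ = Play.step π′ j} (at≡ (ℕ.<⇒≤ j<k)) (at≡ j<k))

    sumEL-cong : ∀ {j} → j ≤ k → sumEL G π j ≡ sumEL G π′ j
    sumEL-cong {zero}  _   = refl
    sumEL-cong {suc j} j<k = cong₂ ℤ._+_ (sumEL-cong (ℕ.<⇒≤ j<k)) (EL-cong j<k)

    excessAt-cong : ∀ {j} → j ≤ k → excessAt π j ≡ excessAt π′ j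
    excessAt-cong {j} j≤k = cong (λ s → ↧ t ℤ.* s ℤ.- ↥ t ℤ.* + j) (sumEL-cong j≤k)

  module _ (π : Play G) (a k-1 : ℕ)
    (periodic : ∀ i → Play.at π (i ℕ.+ (suc k-1 ℕ.+ a)) ≡ Play.at π (i ℕ.+ a))
    (energy : EnergyL G 0 π) (average : AvgEnergy G t π) where

    private
      k b : ℕ
      k = suc k-1
      b = k ℕ.+ a

    EL-shift : ∀ i → EL G π (i ℕ.+ b) ≡ EL G π (i ℕ.+ a) ℤ.+ (EL G π b ℤ.- EL G π a)
    EL-shift zero    = identity (EL G π b) (EL G π a)
      where
      identity : ∀ x y → x ≡ y ℤ.+ (x ℤ.- y)
      identity = ℤ-Solver.solve-∀
    EL-shift (suc i) = trans
      (cong₂ ℤ._+_ (EL-shift i)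
        (weight-cong {h₁ = Play.step π (i ℕ.+ b)} {h₂ = Play.step π (i ℕ.+ a)} (periodic i) (periodic (suc i))))
      (identity (EL G π (i ℕ.+ a)) _ (weight (_ , _ , Play.step π (i ℕ.+ a))))
      where
      identity : ∀ x d w → (x ℤ.+ d) ℤ.+ w ≡ (x ℤ.+ w) ℤ.+ d
      identity = ℤ-Solver.solve-∀

    -- Each period loses at least 1, so after `∣ EL π a ∣ + 1` periods the energy is negative.
    falling⇒⊥ : EL G π b ℤ.< EL G π a → ⊥
    falling⇒⊥ ELb<ELa = ℕ.<-irrefl refl (ℤ.drop‿+≤+ (ℤ.≤-trans lower upper))
      where
      X n : ℕ
      X = ∣ EL G π a ∣
      n = (suc X ℕ.* k ℕ.+ 0) ℕ.+ a
      identity : ∀ x j y → (x ℤ.- y) ℤ.- j ≡ (ℤ.- y) ℤ.- (ℤ.- x ℤ.+ j)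
      identity = ℤ-Solver.solve-∀
      identity′ : ∀ x X y → X ℤ.- (x ℤ.- y) ≡ ((0ℤ ℤ.+ y) ℤ.+ X) ℤ.- (0ℤ ℤ.+ x)
      identity′ = ℤ-Solver.solve-∀
      grows : ∀ i → ℤ.- EL G π (i ℕ.+ a) ℤ.+ 1ℤ ℤ.≤ ℤ.- EL G π (i ℕ.+ b)
      grows i = ≤-by-difference (ℤ.i<j⇒suc[i]≤j ELb<ELa)
        (trans (cong (λ e → ℤ.- e ℤ.- (ℤ.- EL G π (i ℕ.+ a) ℤ.+ 1ℤ)) (EL-shift i))
          (identity″ (EL G π (i ℕ.+ a)) (EL G π b) (EL G π a)))
        where
        identity″ : ∀ e x y → ℤ.- (e ℤ.+ (x ℤ.- y)) ℤ.- (ℤ.- e ℤ.+ 1ℤ) ≡ y ℤ.- (1ℤ ℤ.+ x)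
        identity″ = ℤ-Solver.solve-∀
      lower : + suc X ℤ.≤ EL G π a ℤ.- EL G π n
      lower = ≤-by-difference (periodic-growth (ℤ.-_ ∘ EL G π) a k 0 (λ i _ → grows i) (suc X))
        (identity (EL G π a) (+ suc X) (EL G π n))
      upper : EL G π a ℤ.- EL G π n ℤ.≤ + X
      upper = ≤-by-difference (ℤ.+-mono-≤ (energy n) (i≤∣i∣ (EL G π a)))
        (identity′ (EL G π a) (+ X) (EL G π n))

    growing⇒⊥ : ∀ i₀ → (∀ i → i₀ ≤ i → excessAt π (i ℕ.+ a) ℤ.+ 1ℤ ℤ.≤ excessAt π (i ℕ.+ b)) → ⊥
    growing⇒⊥ i₀ grows = from-small (limsup≤⇒small-excess t (sumEL G π ∘ suc) average (k-1 ℕ.+ suc (k-1 ℕ.+ 0)))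
      where
      from-small : (∃[ N ] ∀ n → N ≤ n → + (2 ℕ.* k) ℤ.* excessAt π (suc n) ℤ.≤ + suc n) → ⊥
      from-small (N , small) = linear-growth⇒⊥ (excessAt π) k-1 (i₀ ℕ.+ a) N (excessAt π (i₀ ℕ.+ a))
        (λ j → subst (λ n → excessAt π (i₀ ℕ.+ a) ℤ.+ + j ℤ.≤ excessAt π n) (ℕ.+-assoc (j ℕ.* k) i₀ a)
          (periodic-growth (excessAt π) a k i₀ grows j))
        λ { (suc n) (s≤s N≤n) → small n N≤n }

    gain : ℕ → ℤ
    gain i = excessAt π (i ℕ.+ b) ℤ.- excessAt π (i ℕ.+ a)

    -- Moving the window of one period by a step trades a level for the one a period later, which
    -- differs by the energy of the cycle.
    gain-suc : ∀ i → gain (suc i) ≡ gain i ℤ.+ ↧ t ℤ.* (EL G π b ℤ.- EL G π a)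
    gain-suc i = trans
      (cong₂ ℤ._-_ (trans (excessAt-suc π (i ℕ.+ b)) (cong (λ e → excessAt π (i ℕ.+ b) ℤ.+ (↧ t ℤ.* e ℤ.- ↥ t)) (EL-shift (suc i))))
                   (excessAt-suc π (i ℕ.+ a)))
      (identity (excessAt π (i ℕ.+ b)) (excessAt π (i ℕ.+ a)) (↧ t) (↥ t) (EL G π (suc i ℕ.+ a)) (EL G π b ℤ.- EL G π a))
      where
      identity : ∀ f g q p e d → (f ℤ.+ (q ℤ.* (e ℤ.+ d) ℤ.- p)) ℤ.- (g ℤ.+ (q ℤ.* e ℤ.- p)) ≡ (f ℤ.- g) ℤ.+ q ℤ.* d
      identity = ℤ-Solver.solve-∀

    gain⇒grows : ∀ i → 1ℤ ℤ.≤ gain i → excessAt π (i ℕ.+ a) ℤ.+ 1ℤ ℤ.≤ excessAt π (i ℕ.+ b)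
    gain⇒grows i 1≤gain = ≤-by-difference 1≤gain (identity (excessAt π (i ℕ.+ a)) (excessAt π (i ℕ.+ b)))
      where
      identity : ∀ x y → y ℤ.- (x ℤ.+ 1ℤ) ≡ (y ℤ.- x) ℤ.- 1ℤ
      identity = ℤ-Solver.solve-∀

    -- With cycle energy 0 every period gains the same positive excess.
    balanced⇒⊥ : EL G π a ≡ EL G π b → excessAt π a ℤ.< excessAt π b → ⊥
    balanced⇒⊥ ELa≡ELb excess-gain = growing⇒⊥ 0 λ i _ → gain⇒grows i (subst (1ℤ ℤ.≤_) (sym (gain≡ i)) 1≤gain0)
      where
      1≤gain0 : 1ℤ ℤ.≤ gain 0
      1≤gain0 = ≤-by-difference (ℤ.i<j⇒suc[i]≤j excess-gain) (identity (excessAt π a) (excessAt π b))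
        where
        identity : ∀ x y → (y ℤ.- x) ℤ.- 1ℤ ≡ y ℤ.- (1ℤ ℤ.+ x)
        identity = ℤ-Solver.solve-∀
      gain≡ : ∀ i → gain i ≡ gain 0
      gain≡ zero    = refl
      gain≡ (suc i) = begin
        gain (suc i)                                        ≡⟨ gain-suc i ⟩
        gain i ℤ.+ ↧ t ℤ.* (EL G π b ℤ.- EL G π a)          ≡⟨ cong (λ e → gain i ℤ.+ ↧ t ℤ.* (EL G π b ℤ.- e)) ELa≡ELb ⟩
        gain i ℤ.+ ↧ t ℤ.* (EL G π b ℤ.- EL G π b)          ≡⟨ identity (gain i) (↧ t) (EL G π b) ⟩
        gain i                                              ≡⟨ gain≡ i ⟩
        gain 0                                              ∎
        where
        open ≡-Reasoning
        identity : ∀ x q e → x ℤ.+ q ℤ.* (e ℤ.- e) ≡ x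
        identity = ℤ-Solver.solve-∀

    -- The gain per period increases with every shift, so it is positive from shift `∣ gain 0 ∣ + 1`
    -- on.
    rising⇒⊥ : EL G π a ℤ.< EL G π b → ⊥
    rising⇒⊥ ELa<ELb = growing⇒⊥ (suc ∣ gain 0 ∣) λ i i₀≤i → gain⇒grows i (≤-by-difference
      (ℤ.+-mono-≤ (ℤ.+-mono-≤ (gain≥ i) (ℤ.+≤+ i₀≤i)) (-∣i∣≤i (gain 0)))
      (identity (gain i) (gain 0) (+ ∣ gain 0 ∣) (+ i)))
      where
      identity : ∀ x g X i → x ℤ.- 1ℤ ≡ ((x ℤ.+ i) ℤ.+ g) ℤ.- ((g ℤ.+ i ℤ.+ (1ℤ ℤ.+ X)) ℤ.+ ℤ.- X)
      identity = ℤ-Solver.solve-∀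
      1≤d : 1ℤ ℤ.≤ EL G π b ℤ.- EL G π a
      1≤d = ≤-by-difference (ℤ.i<j⇒suc[i]≤j ELa<ELb) (identity′ (EL G π a) (EL G π b))
        where
        identity′ : ∀ x y → (y ℤ.- x) ℤ.- 1ℤ ≡ y ℤ.- (1ℤ ℤ.+ x)
        identity′ = ℤ-Solver.solve-∀
      1≤qd : 1ℤ ℤ.≤ ↧ t ℤ.* (EL G π b ℤ.- EL G π a)
      1≤qd = ℤ.≤-trans (ℤ.+≤+ (s≤s z≤n)) (ℤ.≤-trans (ℤ.≤-reflexive (sym (ℤ.*-identityʳ (↧ t)))) (ℤ.*-monoˡ-≤-nonNeg (↧ t) 1≤d))
      gain≥ : ∀ i → gain 0 ℤ.+ + i ℤ.≤ gain i
      gain≥ zero    = ℤ.≤-reflexive (ℤ.+-identityʳ (gain 0))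
      gain≥ (suc i) = begin
        gain 0 ℤ.+ (1ℤ ℤ.+ + i)                             ≡⟨ identity′ (gain 0) (+ i) ⟩
        (gain 0 ℤ.+ + i) ℤ.+ 1ℤ                             ≤⟨ ℤ.+-mono-≤ (gain≥ i) 1≤qd ⟩
        gain i ℤ.+ ↧ t ℤ.* (EL G π b ℤ.- EL G π a)          ≡⟨ gain-suc i ⟨
        gain (suc i)                                        ∎
        where
        open ℤ.≤-Reasoning
        identity′ : ∀ g i → g ℤ.+ (1ℤ ℤ.+ i) ≡ (g ℤ.+ i) ℤ.+ 1ℤ
        identity′ = ℤ-Solver.solve-∀

-- Search through memoryless strategies, and loop erasure of arbitrary plays

module SecondPlayer (I : Instance) (S₁=∅ : Instance.size I one ≡ 0) where
  open Instance I
  open Games game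
  open Excesses game threshold

  fin₁-elim : ∀ {ℓ} {A : Set ℓ} → Fin (size one) → A
  fin₁-elim k with () ← subst Fin S₁=∅ k

  N : ℕ
  N = ∣S∣

  -- Memoryless strategies are encoded as numbers, to search through them.
  Code : Set
  Code = Fin (N ℕ.^ N)

  target : Code → State → State
  target c s = lookup states (finToFun {N} {N} c (idx s))

  -- A code is an arbitrary map on states; where it prescribes no edge, a default successor is
  -- taken.
  sanitise : ∀ s s′ → Dec (T (edge s s′)) → Successor s
  sanitise s s′ (yes h) = s′ , h
  sanitise s s′ (no _)  = total s

  sanitise-yes : ∀ {s s′} d → T (edge s s′) → proj₁ (sanitise s s′ d) ≡ s′
  sanitise-yes (yes _) h = refl
  sanitise-yes (no ¬h) h = contradiction h ¬h

  choice : Code → ∀ s → Successor s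
  choice c s = sanitise s (target c s) (T? (edge s (target c s)))

  choice-cong : ∀ c c′ s → target c s ≡ target c′ s → proj₁ (choice c s) ≡ proj₁ (choice c′ s)
  choice-cong c c′ s eq = cong (λ s′ → proj₁ (sanitise s s′ (T? (edge s s′)))) eq

  override : Code → ∀ x → State → ∀ i → Dec (i ≡ idx x) → Fin N
  override c x y i (yes _) = idx y
  override c x y i (no _)  = finToFun {N} {N} c i

  redirect : Code → State → State → Code
  redirect c x y = funToFin {N} {N} (λ i → override c x y i (i Fin.≟ idx x))

  choice-redirect : ∀ c {x y} → T (edge x y) → proj₁ (choice (redirect c x y) x) ≡ y
  choice-redirect c {x} {y} h = trans
    (cong (λ s′ → proj₁ (sanitise x s′ (T? (edge x s′)))) target≡)
    (sanitise-yes (T? (edge x y)) h)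
    where
    override≡ : ∀ d → override c x y (idx x) d ≡ idx y
    override≡ (yes _) = refl
    override≡ (no ≢)  = contradiction refl ≢
    target≡ : target (redirect c x y) x ≡ y
    target≡ = trans (cong (lookup states)
      (trans (Fin.finToFun-funToFin (λ i → override c x y i (i Fin.≟ idx x)) (idx x)) (override≡ (idx x Fin.≟ idx x))))
      (lookup-idx y)

  choice-redirect-≢ : ∀ c {x y z} → z ≢ x → proj₁ (choice (redirect c x y) z) ≡ proj₁ (choice c z)
  choice-redirect-≢ c {x} {y} {z} z≢x = choice-cong (redirect c x y) c z (cong (lookup states)
    (trans (Fin.finToFun-funToFin (λ i → override c x y i (i Fin.≟ idx x)) (idx z)) (override≡ (idx z Fin.≟ idx x))))
    where
    override≡ : ∀ d → override c x y (idx z) d ≡ finToFun {N} {N} c (idx z)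
    override≡ (yes eq) = contradiction (idx-injective eq) z≢x
    override≡ (no _)   = refl

  visit : Code → ℕ → State
  visit c zero    = init
  visit c (suc n) = proj₁ (choice c (visit c n))

  play : Code → Play game
  play c = record { at = visit c ; step = λ n → proj₂ (choice c (visit c n)) }

  e : Code → ℕ → ℤ
  e c = EL game (play c)

  visit-periodic : ∀ c {a b} → visit c a ≡ visit c b → ∀ i → visit c (i ℕ.+ b) ≡ visit c (i ℕ.+ a)
  visit-periodic c eq zero    = sym eq
  visit-periodic c eq (suc i) = cong (λ s → proj₁ (choice c s)) (visit-periodic c eq i)

  -- Decidable reasons for the lasso with cycle from `a` to `b` to fail: a negative level, nonzero
  -- cycle energy, or positive cycle surplus.
  Violation : Code → ℕ → ℕ → Set
  Violation c a b = (∃[ n ] n < suc b × ¬ 0ℤ ℤ.≤ e c n) ⊎ e c a ≢ e c b ⊎ excessAt (play c) a ℤ.< excessAt (play c) b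

  -- Among the positions 0 to `N` some state repeats, so it is enough to search for cycles closing
  -- by time `N`.
  Bad : Code → Set
  Bad c = ∃[ b ] b < suc N × (∃[ a ] a < b × (visit c a ≡ visit c b × Violation c a b))

  bad? : ∀ c → Dec (Bad c)
  bad? c = ℕ.anyUpTo? (λ b → ℕ.anyUpTo? (λ a → (visit c a ≟ₛ visit c b) ×-dec
    (ℕ.anyUpTo? (λ n → ¬? (0ℤ ℤ.≤? e c n)) (suc b) ⊎-dec
      (¬? (e c a ℤ.≟ e c b) ⊎-dec (excessAt (play c) a ℤ.<? excessAt (play c) b)))) b) (suc N)

  bad⇒∉AEL : ∀ c → Bad c → ¬ AEL (play c)
  bad⇒∉AEL c (b , _ , a , a<b , eq , violation) (energy , average) = by-offset (ℕ.m≤n⇒∃[o]m+o≡n a<b)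
    where
    by-violation : ∀ k-1 → suc k-1 ℕ.+ a ≡ b → ⊥
    by-violation k-1 refl = cases violation (ℤ.<-cmp (e c a) (e c b))
      where
      periodic = visit-periodic c eq
      cases : Violation c a b → _ → ⊥
      cases (inj₁ (n , _ , e≱0)) _ = e≱0 (subst (0ℤ ℤ.≤_) (ℤ.+-identityˡ _) (energy n))
      cases _ (tri< rising _ _) = rising⇒⊥ (play c) a k-1 periodic energy average rising
      cases _ (tri> _ _ falling) = falling⇒⊥ (play c) a k-1 periodic energy average falling
      cases (inj₂ (inj₁ e≢)) (tri≈ _ e≡ _) = e≢ e≡
      cases (inj₂ (inj₂ excess-gain)) (tri≈ _ e≡ _) = balanced⇒⊥ (play c) a k-1 periodic energy average e≡ excess-gain
    by-offset : (∃[ o ] suc a ℕ.+ o ≡ b) → ⊥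
    by-offset (o , eq) = by-violation o (trans (cong suc (ℕ.+-comm o a)) eq)

  strategy : Code → Strategy game two
  strategy c s₀ k h = choice c (two , k)

  module _ (c : Code) (σ : Strategy game one) where
    private
      π : Play game
      π = outcome game σ (strategy c) init

    move-≡ : ∀ s (h : Prefix game init s) → proj₁ (move game σ (strategy c) init s h) ≡ proj₁ (choice c s)
    move-≡ (one , k) h = fin₁-elim k
    move-≡ (two , k) h = refl

    visit≡at : ∀ n → visit c n ≡ Play.at π n
    visit≡at zero    = refl
    visit≡at (suc n) = trans (cong (λ s → proj₁ (choice c s)) (visit≡at n))
      (sym (move-≡ (Play.at π n) (proj₂ (prefix game σ (strategy c) init n))))

    AEL-outcome⇒AEL-play : AEL π → AEL (play c)
    AEL-outcome⇒AEL-play (energy , average) =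
      (λ n → subst (λ i → 0ℤ ℤ.≤ 0ℤ ℤ.+ i) (sym (EL-cong (play c) π n (λ {j} _ → visit≡at j) ℕ.≤-refl)) (energy n)) ,
      λ ε 0<ε → let M , tail = average ε 0<ε in M , λ n M≤n →
        subst (λ s → s ℚ./ suc n ℚ.≤ threshold ℚ.+ ε)
          (sym (sumEL-cong (play c) π (suc n) (λ {j} _ → visit≡at j) ℕ.≤-refl)) (tail n M≤n)

  bad⇒wins : ∀ c → Bad c → Wins₂ (strategy c)
  bad⇒wins c bad σ π∈AEL = bad⇒∉AEL c bad (AEL-outcome⇒AEL-play c σ π∈AEL)

  module _ (¬bad : ∀ c → ¬ Bad c) where

    good : ∀ c {a b} → a < b → b ≤ N → visit c a ≡ visit c b →
      (∀ {n} → n ≤ b → 0ℤ ℤ.≤ e c n) × e c a ≡ e c b × excessAt (play c) b ℤ.≤ excessAt (play c) a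
    good c {a} {b} a<b b≤N eq =
      (λ {n} n≤b → decidable-stable (0ℤ ℤ.≤? e c n) λ e≱0 → no-violation (inj₁ (n , s≤s n≤b , e≱0))) ,
      decidable-stable (e c a ℤ.≟ e c b) (no-violation ∘ inj₂ ∘ inj₁) ,
      ℤ.≮⇒≥ (no-violation ∘ inj₂ ∘ inj₂)
      where
      no-violation : ¬ Violation c a b
      no-violation v = ¬bad c (b , s≤s b≤N , a , a<b , eq , v)

    Simple : Code → ℕ → Set
    Simple c k = ∀ {i j} → i < j → j ≤ k → visit c i ≢ visit c j

    simple⇒k<N : ∀ c {k} → Simple c k → k < N
    simple⇒k<N c {k} simple = ℕ.≰⇒> λ N≤k →
      let i , j , i<j , eq = Fin.pigeonhole (s≤s N≤k) (λ (i : Fin (suc k)) → idx (visit c (toℕ i)))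
      in simple i<j (ℕ.≤-pred (Fin.toℕ<n j)) (idx-injective eq)

    -- The play of `c` repeats a state by time `N`, but not before `k`; the energy is nonnegative up
    -- to that repetition.
    simple⇒0≤e : ∀ c {k} → Simple c k → 0ℤ ℤ.≤ e c k
    simple⇒0≤e c {k} simple =
      let i , j , i<j , eq = Fin.pigeonhole (ℕ.n<1+n N) (λ (i : Fin (suc N)) → idx (visit c (toℕ i)))
          k≤j = ℕ.≮⇒≥ λ j<k → simple i<j (ℕ.<⇒≤ j<k) (idx-injective eq)
      in proj₁ (good c i<j (ℕ.≤-pred (Fin.toℕ<n j)) (idx-injective eq)) k≤j

    -- Only finitely many codes and positions are involved.
    excess-bounded : ∃[ C ] ∀ c {k} → k < N → excessAt (play c) k ℤ.≤ + C
    excess-bounded = let C , C≤ = bounded (λ c → + proj₁ (inner c)) in C , λ c k<N →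
      ℤ.≤-trans (subst (λ k → excessAt (play c) k ℤ.≤ + proj₁ (inner c)) (Fin.toℕ-fromℕ< k<N)
        (proj₂ (inner c) (fromℕ< k<N))) (C≤ c)
      where
      inner : ∀ c → ∃[ C ] ∀ (k : Fin N) → excessAt (play c) (toℕ k) ℤ.≤ + C
      inner c = bounded (λ k → excessAt (play c) (toℕ k))

    module _ (π : Play game) (start : Play.at π 0 ≡ init) where
      open Play π

      -- The loop-erasure of the prefix of length n is traced by a memoryless
      -- strategy; the erased loops have energy 0 and nonpositive excess.
      record Erased (n : ℕ) : Set where
        field
          c       : Code
          k       : ℕ
          visit≡  : visit c k ≡ at n
          simple  : Simple c k
          e≡      : e c k ≡ EL game π n
          excess≥ : excessAt π n ℤ.≤ excessAt (play c) k

      erased-zero : Erased 0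
      erased-zero = record
        { c = funToFin {N} {N} id ; k = 0 ; visit≡ = sym start
        ; simple = λ { (s≤s _) () } ; e≡ = refl ; excess≥ = ℤ.≤-refl }

      module _ (n : ℕ) (E : Erased n) where
        open Erased E

        -- A simple path visits its end only once, so redirecting the end to the next state of `π`
        -- leaves the path itself unchanged.
        c′ : Code
        c′ = redirect c (visit c k) (at (suc n))

        visit-c′ : ∀ {j} → j ≤ k → visit c′ j ≡ visit c j
        visit-c′ {zero}  _   = refl
        visit-c′ {suc j} j<k = trans (cong (λ s → proj₁ (choice c′ s)) (visit-c′ (ℕ.<⇒≤ j<k)))
          (choice-redirect-≢ c (simple j<k ℕ.≤-refl))

        visit-end : visit c′ (suc k) ≡ at (suc n)
        visit-end = trans (cong (λ s → proj₁ (choice c′ s)) (visit-c′ ℕ.≤-refl))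
          (choice-redirect c (subst (λ s → T (edge s (at (suc n)))) (sym visit≡) (step n)))

        e-end : e c′ (suc k) ≡ EL game π (suc n)
        e-end = cong₂ ℤ._+_ (trans (EL-cong (play c′) (play c) k visit-c′ ℕ.≤-refl) e≡)
          (weight-cong {h₁ = Play.step (play c′) k} {h₂ = step n} (trans (visit-c′ ℕ.≤-refl) visit≡) visit-end)

        excess-end : excessAt π (suc n) ℤ.≤ excessAt (play c′) (suc k)
        excess-end = begin
          excessAt π (suc n)                                                     ≡⟨ excessAt-suc π n ⟩
          excessAt π n ℤ.+ (↧ threshold ℤ.* EL game π (suc n) ℤ.- ↥ threshold)   ≤⟨ ℤ.+-monoˡ-≤ _ excess≥ ⟩
          excessAt (play c) k ℤ.+ (↧ threshold ℤ.* EL game π (suc n) ℤ.- ↥ threshold)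
            ≡⟨ cong₂ (λ f x → f ℤ.+ (↧ threshold ℤ.* x ℤ.- ↥ threshold))
                 (sym (excessAt-cong (play c′) (play c) k visit-c′ ℕ.≤-refl)) (sym e-end) ⟩
          excessAt (play c′) k ℤ.+ (↧ threshold ℤ.* e c′ (suc k) ℤ.- ↥ threshold) ≡⟨ excessAt-suc (play c′) k ⟨
          excessAt (play c′) (suc k)                                             ∎
          where open ℤ.≤-Reasoning

        simple-c′ : Simple c′ k
        simple-c′ i<j j≤k eq = simple i<j j≤k
          (trans (sym (visit-c′ (ℕ.≤-trans (ℕ.<⇒≤ i<j) j≤k))) (trans eq (visit-c′ j≤k)))

        -- If the new state was visited at `j`, the path is cut back to `j`: as `c′` is not bad, the
        -- loop has energy 0 and nonpositive excess.
        close-or-extend : Dec (∃[ j ] j < suc k × visit c′ j ≡ visit c′ (suc k)) → Erased (suc n)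
        close-or-extend (yes (j , j<1+k , eq)) =
          let _ , e≡′ , excess≤ = good c′ j<1+k (simple⇒k<N c simple) eq in record
          { c = c′ ; k = j ; visit≡ = trans eq visit-end
          ; simple = λ i<j′ j′≤j → simple-c′ i<j′ (ℕ.≤-trans j′≤j (ℕ.≤-pred j<1+k))
          ; e≡ = trans e≡′ e-end ; excess≥ = ℤ.≤-trans excess-end excess≤ }
        close-or-extend (no fresh) = record
          { c = c′ ; k = suc k ; visit≡ = visit-end
          ; simple = λ i<j j≤1+k → extend i<j (ℕ.m≤n⇒m<n∨m≡n j≤1+k)
          ; e≡ = e-end ; excess≥ = excess-end }
          where
          extend : ∀ {i j} → i < j → j < suc k ⊎ j ≡ suc k → visit c′ i ≢ visit c′ j
          extend i<j (inj₁ (s≤s j≤k)) = simple-c′ i<j j≤k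
          extend i<j (inj₂ refl)      = λ eq → fresh (_ , i<j , eq)

        erased-suc : Erased (suc n)
        erased-suc = close-or-extend (ℕ.anyUpTo? (λ j → visit c′ j ≟ₛ visit c′ (suc k)) (suc k))

      erased : ∀ n → Erased n
      erased zero    = erased-zero
      erased (suc n) = erased-suc n (erased n)

      AEL-play : AEL π
      AEL-play =
        (λ n → let open Erased (erased n) in
          subst (0ℤ ℤ.≤_) (trans e≡ (sym (ℤ.+-identityˡ _))) (simple⇒0≤e c simple)) ,
        bounded-excess⇒limsup≤ threshold (sumEL game π ∘ suc) (proj₁ excess-bounded) λ n →
          let open Erased (erased (suc n)) in ℤ.≤-trans excess≥ (proj₂ excess-bounded c (simple⇒k<N c simple))

  -- Without a bad code every play satisfies the objective, which refutes the given winning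
  -- strategy.
  bad?⇒memoryless : Dec (∃ Bad) → ∃ Wins₂ → ∃[ τ ] Wins₂ τ × Memoryless game τ
  bad?⇒memoryless (yes (c , bad)) _ = strategy c , bad⇒wins c bad , λ _ _ → refl
  bad?⇒memoryless (no ¬bad) (τ , wins) =
    ⊥-elim (wins (λ _ k → fin₁-elim k) (AEL-play (λ c bad → ¬bad (c , bad)) _ refl))

-- The three claims assembled

open Instance

memory-suffices : ∀ (I : Instance) → size I two ≡ 0 → ∃ (Wins₁ I) →
  ∃[ σ ] Wins₁ I σ × (∃[ m ] HasMemory (game I) σ m ×
    m ≤ ⟦ memoryBound ⟧ (∣S∣ I ∷ ∣E∣ I ∷ maxWeight I ∷ ∣num∣ I ∷ den I ∷ []))
memory-suffices I S₂=∅ (σ₀ , wins) = lasso⇒memory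
  (AEL⇒lasso (outcome (game I) σ₀ τ∅ (init I)) (proj₁ (wins τ∅)) (proj₂ (wins τ∅)))
  where open OnePlayer I S₂=∅

memoryless-suffices : ∀ (I : Instance) → size I one ≡ 0 → ∃ (Wins₂ I) →
  ∃[ τ ] Wins₂ I τ × Memoryless (game I) τ
memoryless-suffices I S₁=∅ = bad?⇒memoryless (Fin.any? bad?)
  where open SecondPlayer I S₁=∅

theorem10 : (Σ[ P ∈ Poly 5 ] ∀ (I : Instance) → size I two ≡ 0 →
    ∃ (Wins₁ I) →
    ∃[ σ ] Wins₁ I σ × (∃[ m ] HasMemory (game I) σ m ×
    m ≤ ⟦ P ⟧ (∣S∣ I ∷ ∣E∣ I ∷ maxWeight I ∷ ∣num∣ I ∷ den I ∷ [])))
    ×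
    (Σ[ F ∈ (ℕ → Instance) ]
    (∀ k → size (F k) two ≡ 0) ×
    (∀ k → ∃ (Wins₁ (F k))) ×
    (∀ B → ∃[ k ] B ≤ maxWeight (F k)) ×
    (Σ[ P ∈ Poly 1 ] ∀ k →
    encodingSize (F k) ≤ ⟦ P ⟧ (⌊log₂ maxWeight (F k) ⌋ ∷ [])) ×
    (∃[ p ] ∃[ q ] 0 < p × 0 < q × (∃[ W₀ ] ∀ k → W₀ ≤ maxWeight (F k) →
    ∀ σ → Wins₁ (F k) σ → ∀ m → HasMemory (game (F k)) σ m →
    maxWeight (F k) ^ p ≤ m ^ q)) ×
    (∀ (P : Poly 1) → ∃[ k ]
    ∀ σ → Wins₁ (F k) σ → ∀ m → HasMemory (game (F k)) σ m →
    ⟦ P ⟧ (encodingSize (F k) ∷ []) < m))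
    ×
    (∀ (I : Instance) → size I one ≡ 0 →
    ∃ (Wins₂ I) →
    ∃[ τ ] Wins₂ I τ × Memoryless (game I) τ)
theorem10 = (memoryBound , memory-suffices) , Gates.memory-necessary , memoryless-suffices
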